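{- Let $p$ be a prime, $l,n\in\mathbb N$, $r\in\mathbb Z$ and $s,t\in\{0,\ldots,p-1\}$. If $p\mid n$, or $p-1\nmid n-l-1$, or $s=p-1$, or ($s=2t$ and $p\neq 2$), then $$\left\{\begin{matrix} pn+s\\ pr+t\end{matrix}\right\}_{l,p^{2}}\equiv(-1)^t\binom st\left\{\begin{matrix} n\\ r\end{matrix}\right\}_{l,p}\pmod p .$$ When $p\nmid n$, $p-1\mid n-l-1$ and $s<t\leqslant p-1$, we have $$\left\{\begin{matrix} pn+s\\ pr+t\end{matrix}\right\}_{l,p^{2}}\equiv\begin{cases}(-1)^{s+\frac{n-l-1}{p-1}}\,\dfrac nt\binom{\frac{n-l-1}{p-1}-1}{l}\Big/\binom{t-1}s \pmod p&\text{if } n>l+1,\\ 0\pmod p&\text{if } n\leqslant l+1.\end{cases}$$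
   Context: $\mathbb N=\{0,1,2,\ldots\}$. Binomial coefficients: $\binom x0=1$, $\binom xk=x(x-1)\cdots(x-k+1)/k!$ for $k\in\mathbb Z^+$ (for arbitrary rational $x$), and $\binom x{k}=0$ for negative integers $k$. For a prime $p$, $b\in\mathbb Z^+$, $l,n\in\mathbb N$ and $r\in\mathbb Z$, the normalized cyclotomic $\psi$-coefficient is $$\left\{\begin{matrix} n\\ r\end{matrix}\right\}_{l,p^{b}}:=p^{ -\left\lfloor\frac{n-p^{b-1}-lp^{b}}{\phi(p^{b})}\right\rfloor}\sum_{k\equiv r\,(\mathrm{mod}\ p^{b})}(-1)^k\binom nk\binom{(k-r)/p^{b}}l,$$ where the sum is over all integers $k\equiv r \pmod{p^b}$, $\phi$ is Euler's totient function and $\lfloor\cdot\rfloor$ the floor function. These numbers are integers. Division by $t$ and $\binom{t-1}{s}$ (both prime to $p$) is understood modulo $p$. -}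

module Defs where

open import Data.Nat as ℕ using (ℕ; zero; suc; _!)
open import Data.Nat.GCD using (gcd)
open import Data.Nat.Combinatorics using (_C_)
open import Data.Integer as ℤ using (ℤ; +_; -[1+_]; _-_; _*_; _^_; -1ℤ; 0ℤ; 1ℤ)
import Data.Integer.Base as ℤB
open import Data.List using (List; upTo; map; filter; length; foldr)
open import Data.Bool using (if_then_else_)
open import Relation.Nullary.Decidable using (does)
open import Data.Integer.Divisibility renaming (_∣_ to _∣ℤ_)

-- Floor division of an integer by a natural number (Euclidean = floor
-- for positive divisors).  Division by 0 is set to 0 (never used).
_divℕ_ : ℤ → ℕ → ℤ
i divℕ zero = 0ℤ
i divℕ suc d = ℤB._/ℕ_ i (suc d)

_modℕ_ : ℤ → ℕ → ℕ
i modℕ zero = 0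
i modℕ suc d = ℤB._%ℕ_ i (suc d)

totient : ℕ → ℕ
totient m = length (filter (λ k → gcd k m ℕ.≟ 1) (map suc (upTo m)))

fallingℤ : ℤ → ℕ → ℤ
fallingℤ x zero = 1ℤ
fallingℤ x (suc k) = fallingℤ x k * (x - + k)

-- Generalised binomial coefficient  binom(x, k) = x(x-1)…(x-k+1)/k!
-- for integer x and natural k (the division is exact).
binomℤ : ℤ → ℕ → ℤ
binomℤ x k = fallingℤ x k divℕ (k !)

sumℤ : List ℤ → ℤ
sumℤ = foldr ℤ._+_ 0ℤ

-- The raw sum  Σ_{k ≡ r (mod m)} (-1)^k binom(n,k) binom((k-r)/m, l),
-- where m = p^b.  Since binom(n,k) = 0 unless 0 ≤ k ≤ n, the sum runs
-- over k ∈ {0,…,n}.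
rawψ : ℕ → ℕ → ℕ → ℕ → ℤ → ℤ
rawψ l p b n r =
  sumℤ (map (λ k → if does ((+ k - r) modℕ (p ℕ.^ b) ℕ.≟ 0)
                   then (-1ℤ ^ k) * (+ (n C k)) * binomℤ ((+ k - r) divℕ (p ℕ.^ b)) l
                   else 0ℤ)
            (upTo (suc n)))

ψexp : ℕ → ℕ → ℕ → ℕ → ℤ
ψexp l p b n = (+ n - + (p ℕ.^ (b ℕ.∸ 1)) - + (l ℕ.* p ℕ.^ b)) divℕ totient (p ℕ.^ b)

-- Multiply an integer by p^(-e) (for e > 0 this division is exact).
scaleByNegPow : ℕ → ℤ → ℤ → ℤ
scaleByNegPow p (+ k) x = x divℕ (p ℕ.^ k)
scaleByNegPow p -[1+ k ] x = x * + (p ℕ.^ suc k)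

ψcoeff : (l p b n : ℕ) → (r : ℤ) → ℤ
ψcoeff l p b n r = scaleByNegPow p (ψexp l p b n) (rawψ l p b n r)

infix 4 _≡_[mod_]
_≡_[mod_] : ℤ → ℤ → ℕ → Set
a ≡ b [mod m ] = (+ m) ∣ℤ (a - b)

{-# OPTIONS --safe #-}

-- Let E be the shift of functions ℤ → ℤ, δ = 1 - E and, for the prime p, Y = 1 - E^p. The alternating sum defining
-- a ψ-coefficient is δ^n applied to the function supported on the multiples of p^b with value binom(k/p^b, l)
-- there, evaluated at -r. The binomial theorem gives δ^p = Y + pδ(δQ - 1) for some polynomial Q in E. Since Y lowers
-- l by one up to sign, this is a recurrence in n; it yields the p-divisibility of the sums for modulus p, and their
-- leading term when p - 1 divides n - l.
--
-- For modulus p², Y acts on functions supported on the multiples of p as δ does after rescaling. Hence δ^s Y^n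
-- produces the right-hand side of the first congruence, and expanding δ^(pn+s) = δ^s (Y + pG)^n to first order leaves
-- only the correction n p G δ^s Y^(n-1). It vanishes to higher order unless p - 1 divides n - l - 1, and then it is
-- the leading term for n - 1 times the sum of (-1)^k C(p+s, k) over k ≡ t (mod p).

module Submission where

open import Defs
open import Data.Nat using (ℕ; zero; suc; _+_; _*_; _∸_; _<_; _≤_; _>_; s≤s; z≤n; _!)
import Data.Nat as ℕ
import Data.Nat.Properties as ℕₚ
open import Data.Nat.Divisibility using (_∣_)
import Data.Nat.Divisibility as ∣ₚ
open import Data.Nat.GCD using (gcd; gcd-greatest)
open import Data.Nat.Coprimality using (Coprime; coprime-divisor; coprime⇒gcd≡1)
open import Data.Nat.Primality using (Prime; euclidsLemma; prime⇒irreducible)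
open import Data.Nat.Combinatorics using (_C_; nCk+nC[k+1]≡[n+1]C[k+1]; k>n⇒nCk≡0; nCn≡1; nC1≡n)
open import Data.Nat.Tactic.RingSolver using () renaming (solve-∀ to ℕ-solve-∀)
open import Data.Integer using (ℤ; +_; -[1+_]; -1ℤ; 0ℤ; 1ℤ; -_; _^_; _-_) renaming (_*_ to _*ℤ_; _+_ to _+ℤ_)
import Data.Integer as ℤ
import Data.Integer.Properties as ℤₚ
import Data.Integer.DivMod as ℤ÷
open import Data.Integer.Divisibility using () renaming (_∣_ to _∣ℤ_)
open import Data.Integer.Divisibility.Signed using (divides) renaming (_∣_ to _∣ˢ_)
import Data.Integer.Divisibility.Signed as S
open import Data.Integer.Tactic.RingSolver using (solve-∀)
open import Data.Bool using (true; false; if_then_else_)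
open import Data.Fin using (Fin; zero; suc; toℕ; fromℕ; inject₁)
import Data.Fin.Properties as Finₚ
open import Data.List using (applyUpTo; []; _∷_; _++_; length; filter)
import Data.List.Properties as Listₚ
import Data.List.Relation.Unary.All.Properties as Allₚ
open import Data.Maybe using (Maybe)
import Data.Maybe as Maybe
open import Data.Product using (_×_; _,_; proj₁; proj₂; ∃-syntax)
open import Data.Sum using (_⊎_; inj₁; inj₂)
open import Data.Vec.Functional using (init; last)
open import Relation.Nullary using (¬_; yes; no; contradiction)
open import Relation.Nullary.Decidable using (does; dec⇒maybe)
open import Relation.Binary.Definitions using (tri<; tri≈; tri>)
open import Relation.Binary.PropositionalEquality
open import Algebra.Bundles using (CommutativeRing)
open import Algebra.Solver.Ring.AlmostCommutativeRing using (fromCommutativeRing; _-Raw-AlmostCommutative⟶_)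
import Algebra.Properties.AbelianGroup ℤₚ.+-0-abelianGroup as ℤ-Group
import Algebra.Solver.Ring
import Relation.Binary.Reasoning.Setoid

-- Polynomials in the shift operator

-- One exponent governs everything. Write n - 1 - lp = ρ + e(p - 1) with 0 ≤ ρ < p - 1. The floor in
-- the normalisation is e both for (n, p) and for (pn + s, p²). If e < 0, the normalisation
-- multiplies by p and both sides vanish modulo p. If e ≥ 0, the claims concern sums divisible by
-- p^e, taken modulo p^(e+1), so the error terms must be better than Y^n by a full factor p. This is
-- measured by weights: Y counts 1, p counts p - 1, and p^e is guaranteed from weight lp + 1 + e(p -
-- 1) on. The target is weight n + p - 1. The correction n p G Y^(n-1) has weight n + p - 2, one
-- unit short, and that unit matters only if n sits exactly on a threshold, that is if ρ = 0. As lp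
-- ≡ l modulo p - 1, this is the condition p - 1 | n - l - 1. The second-order term p²G²Y^(n-2) has
-- weight n + 2p - 4, which is enough except for p = 2; there the missing unit has to come from the
-- factor δ of G.

data Op : Set where
  E       : Op
  K       : ℤ → Op
  _⊕_ _⊗_ : Op → Op → Op

infixl 6 _⊕_
infixl 7 _⊗_

⟦_⟧ : Op → (ℤ → ℤ) → ℤ → ℤ
⟦ E ⟧     f a = f (a +ℤ 1ℤ)
⟦ K c ⟧   f a = c *ℤ f a
⟦ P ⊕ Q ⟧ f a = ⟦ P ⟧ f a +ℤ ⟦ Q ⟧ f a
⟦ P ⊗ Q ⟧ f   = ⟦ P ⟧ (⟦ Q ⟧ f)

infix 4 _≋_
-- Equality of the action, not of the expressions. The wrapper keeps `P` and `Q` visible to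
-- unification, where the bare statement would compute them away.
record _≋_ (P Q : Op) : Set where
  constructor mk≋
  field at : ∀ f a → ⟦ P ⟧ f a ≡ ⟦ Q ⟧ f a
open _≋_

⟦⟧-cong : ∀ P {f g} → (∀ a → f a ≡ g a) → ∀ a → ⟦ P ⟧ f a ≡ ⟦ P ⟧ g a
⟦⟧-cong E       h a = h (a +ℤ 1ℤ)
⟦⟧-cong (K c)   h a = cong (c *ℤ_) (h a)
⟦⟧-cong (P ⊕ Q) h a = cong₂ _+ℤ_ (⟦⟧-cong P h a) (⟦⟧-cong Q h a)
⟦⟧-cong (P ⊗ Q) h   = ⟦⟧-cong P (⟦⟧-cong Q h)

⟦⟧-+ : ∀ P f g a → ⟦ P ⟧ (λ b → f b +ℤ g b) a ≡ ⟦ P ⟧ f a +ℤ ⟦ P ⟧ g a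
⟦⟧-+ E       f g a = refl
⟦⟧-+ (K c)   f g a = ℤₚ.*-distribˡ-+ c (f a) (g a)
⟦⟧-+ (P ⊕ Q) f g a = trans (cong₂ _+ℤ_ (⟦⟧-+ P f g a) (⟦⟧-+ Q f g a)) (interchange (⟦ P ⟧ f a) (⟦ P ⟧ g a) (⟦ Q ⟧ f a) (⟦ Q ⟧ g a))
  where
  interchange : ∀ w x y z → (w +ℤ x) +ℤ (y +ℤ z) ≡ (w +ℤ y) +ℤ (x +ℤ z)
  interchange = solve-∀
⟦⟧-+ (P ⊗ Q) f g a = trans (⟦⟧-cong P (⟦⟧-+ Q f g) a) (⟦⟧-+ P (⟦ Q ⟧ f) (⟦ Q ⟧ g) a)

⟦⟧-* : ∀ P c f a → ⟦ P ⟧ (λ b → c *ℤ f b) a ≡ c *ℤ ⟦ P ⟧ f a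
⟦⟧-* E       c f a = refl
⟦⟧-* (K d)   c f a = swap d c (f a)
  where
  swap : ∀ x y z → x *ℤ (y *ℤ z) ≡ y *ℤ (x *ℤ z)
  swap = solve-∀
⟦⟧-* (P ⊕ Q) c f a = trans (cong₂ _+ℤ_ (⟦⟧-* P c f a) (⟦⟧-* Q c f a)) (sym (ℤₚ.*-distribˡ-+ c _ _))
⟦⟧-* (P ⊗ Q) c f a = trans (⟦⟧-cong P (⟦⟧-* Q c f) a) (⟦⟧-* P c (⟦ Q ⟧ f) a)

⟦⟧-E : ∀ P f a → ⟦ P ⟧ (⟦ E ⟧ f) a ≡ ⟦ P ⟧ f (a +ℤ 1ℤ)
⟦⟧-E E       f a = refl
⟦⟧-E (K c)   f a = refl
⟦⟧-E (P ⊕ Q) f a = cong₂ _+ℤ_ (⟦⟧-E P f a) (⟦⟧-E Q f a)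
⟦⟧-E (P ⊗ Q) f a = trans (⟦⟧-cong P (⟦⟧-E Q f) a) (⟦⟧-E P (⟦ Q ⟧ f) a)

-- This is what the syntax of operators is for. Arbitrary maps on functions do not commute, but
-- every `Op` is built from constants and the single shift `E`, so induction reduces the claim to
-- linearity and `⟦⟧-E`.
⟦⟧-comm : ∀ P Q f a → ⟦ P ⟧ (⟦ Q ⟧ f) a ≡ ⟦ Q ⟧ (⟦ P ⟧ f) a
⟦⟧-comm E       Q f a = sym (⟦⟧-E Q f a)
⟦⟧-comm (K c)   Q f a = sym (⟦⟧-* Q c f a)
⟦⟧-comm (P ⊕ R) Q f a = trans (cong₂ _+ℤ_ (⟦⟧-comm P Q f a) (⟦⟧-comm R Q f a)) (sym (⟦⟧-+ Q _ _ a))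
⟦⟧-comm (P ⊗ R) Q f a = trans (⟦⟧-cong P (⟦⟧-comm R Q f) a) (⟦⟧-comm P Q (⟦ R ⟧ f) a)

-- Opens the binomial theorem, the laws of powers and a ring solver to operators, with the integers
-- as coefficients through `K`.
opRing : CommutativeRing _ _
opRing = record
  { Carrier = Op
  ; _≈_ = _≋_
  ; _+_ = _⊕_
  ; _*_ = _⊗_
  ; -_ = K -1ℤ ⊗_
  ; 0# = K 0ℤ
  ; 1# = K 1ℤ
  ; isCommutativeRing = record
    { isRing = record
      { +-isAbelianGroup = record
        { isGroup = record
          { isMonoid = record
            { isSemigroup = record
              { isMagma = record
                { isEquivalence = record
                  { refl = mk≋ λ f a → refl
                  ; sym = λ e → mk≋ λ f a → sym (at e f a)
                  ; trans = λ d e → mk≋ λ f a → trans (at d f a) (at e f a)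
                  }
                ; ∙-cong = λ d e → mk≋ λ f a → cong₂ _+ℤ_ (at d f a) (at e f a)
                }
              ; assoc = λ P Q R → mk≋ λ f a → ℤₚ.+-assoc (⟦ P ⟧ f a) (⟦ Q ⟧ f a) (⟦ R ⟧ f a)
              }
            ; identity = (λ P → mk≋ λ f a → ℤₚ.+-identityˡ (⟦ P ⟧ f a))
                       , (λ P → mk≋ λ f a → ℤₚ.+-identityʳ (⟦ P ⟧ f a))
            }
          ; inverse = (λ P → mk≋ λ f a → trans (cong (_+ℤ ⟦ P ⟧ f a) (ℤₚ.-1*i≡-i (⟦ P ⟧ f a))) (ℤₚ.+-inverseˡ (⟦ P ⟧ f a)))
                    , (λ P → mk≋ λ f a → trans (cong (⟦ P ⟧ f a +ℤ_) (ℤₚ.-1*i≡-i (⟦ P ⟧ f a))) (ℤₚ.+-inverseʳ (⟦ P ⟧ f a)))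
          ; ⁻¹-cong = λ e → mk≋ λ f a → cong (-1ℤ *ℤ_) (at e f a)
          }
        ; comm = λ P Q → mk≋ λ f a → ℤₚ.+-comm (⟦ P ⟧ f a) (⟦ Q ⟧ f a)
        }
      ; *-cong = λ {_} {P} d e → mk≋ λ f a → trans (at d _ a) (⟦⟧-cong P (at e f) a)
      ; *-assoc = λ P Q R → mk≋ λ f a → refl
      ; *-identity = (λ P → mk≋ λ f a → ℤₚ.*-identityˡ (⟦ P ⟧ f a))
                   , (λ P → mk≋ λ f a → ⟦⟧-cong P (λ b → ℤₚ.*-identityˡ (f b)) a)
      ; distrib = (λ P Q R → mk≋ λ f a → ⟦⟧-+ P (⟦ Q ⟧ f) (⟦ R ⟧ f) a)
                , (λ P Q R → mk≋ λ f a → refl)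
      }
    ; *-comm = λ P Q → mk≋ λ f a → ⟦⟧-comm P Q f a
    }
  }

module Opᴿ = CommutativeRing opRing
open import Algebra.Properties.Semiring.Exp Opᴿ.semiring using (^-homo-*; ^-congˡ; ^-assocʳ) renaming (_^_ to _^ᵒ_)
module ≋-Reasoning = Relation.Binary.Reasoning.Setoid Opᴿ.setoid

module OpSolver where
  K-homomorphism : CommutativeRing.rawRing ℤₚ.+-*-commutativeRing -Raw-AlmostCommutative⟶ fromCommutativeRing opRing
  K-homomorphism = record
    { ⟦_⟧ = K
    ; +-homo = λ c d → mk≋ λ f a → ℤₚ.*-distribʳ-+ (f a) c d
    ; *-homo = λ c d → mk≋ λ f a → ℤₚ.*-assoc c d (f a)
    ; -‿homo = λ c → mk≋ λ f a → trans (cong (_*ℤ f a) (sym (ℤₚ.-1*i≡-i c))) (ℤₚ.*-assoc -1ℤ c (f a))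
    ; 0-homo = Opᴿ.refl
    ; 1-homo = Opᴿ.refl
    }
  K≟ : ∀ c d → Maybe (K c ≋ K d)
  K≟ c d = Maybe.map (λ { refl → Opᴿ.refl }) (dec⇒maybe (c ℤₚ.≟ d))

  open Algebra.Solver.Ring (CommutativeRing.rawRing ℤₚ.+-*-commutativeRing) (fromCommutativeRing opRing) K-homomorphism K≟ public

open OpSolver using (_:+_; _:*_; _:=_; con) renaming (solve to solveᵒ)

δ : Op
δ = K 1ℤ ⊕ K -1ℤ ⊗ E

⟦δ⟧ : ∀ f a → ⟦ δ ⟧ f a ≡ f a - f (a +ℤ 1ℤ)
⟦δ⟧ f a = cong₂ _+ℤ_ (ℤₚ.*-identityˡ (f a)) (ℤₚ.-1*i≡-i (f (a +ℤ 1ℤ)))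

-- Binomial coefficients and functions supported on multiples

divMod-unique : ∀ {i} m q r → r < suc m → i ≡ + r +ℤ q *ℤ + suc m →
                i modℕ suc m ≡ r × i divℕ suc m ≡ q
divMod-unique {i} m q r r<m i≡ = r′≡r , q′≡q
  where
  d = + suc m
  r′ = i modℕ suc m
  q′ = i divℕ suc m
  ≤-from-bounds : ∀ {u v} → u *ℤ d ℤ.≤ i → i ℤ.< ℤ.suc v *ℤ d → u ℤ.≤ v
  ≤-from-bounds {u} {v} lo hi =
    ℤₚ.≤-trans (ℤₚ.i<j⇒i≤pred[j] (ℤₚ.*-cancelʳ-<-nonNeg {u} {ℤ.suc v} d (ℤₚ.≤-<-trans lo hi))) (ℤₚ.≤-reflexive (ℤₚ.pred-suc v))
  qd≤i : q *ℤ d ℤ.≤ i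
  qd≤i = subst (q *ℤ d ℤ.≤_) (sym i≡) (ℤₚ.i≤j+i _ (+ r))
  i<[q+1]d : i ℤ.< ℤ.suc q *ℤ d
  i<[q+1]d = subst₂ ℤ._<_ (sym i≡) (sym (ℤₚ.suc-* q d)) (ℤₚ.+-monoˡ-< (q *ℤ d) (ℤ.+<+ r<m))
  q′≡q : q′ ≡ q
  q′≡q = ℤₚ.≤-antisym (≤-from-bounds (ℤ÷.[n/ℕd]*d≤n i (suc m)) i<[q+1]d)
                      (≤-from-bounds qd≤i (ℤ÷.n<s[n/ℕd]*d i (suc m)))
  r′≡r : r′ ≡ r
  r′≡r = ℤₚ.+-injective (ℤ-Group.∙-cancelʳ (q *ℤ d) _ _ (begin
    + r′ +ℤ q *ℤ d   ≡⟨ cong (λ z → + r′ +ℤ z *ℤ d) q′≡q ⟨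
    + r′ +ℤ q′ *ℤ d  ≡⟨ ℤ÷.a≡a%ℕn+[a/ℕn]*n i (suc m) ⟨
    i                ≡⟨ i≡ ⟩
    + r +ℤ q *ℤ d    ∎))
    where open ≡-Reasoning

*-divℕ : ∀ m q → (q *ℤ + suc m) divℕ suc m ≡ q
*-divℕ m q = proj₂ (divMod-unique m q 0 (s≤s z≤n) (sym (ℤₚ.+-identityˡ (q *ℤ + suc m))))

fallingℤ-suc : ∀ x l → fallingℤ (x +ℤ 1ℤ) (suc l) ≡ (x +ℤ 1ℤ) *ℤ fallingℤ x l
fallingℤ-suc x zero    = base x
  where
  base : ∀ x → 1ℤ *ℤ (x +ℤ 1ℤ - 0ℤ) ≡ (x +ℤ 1ℤ) *ℤ 1ℤ
  base = solve-∀
fallingℤ-suc x (suc l) = begin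
  fallingℤ (x +ℤ 1ℤ) (suc l) *ℤ (x +ℤ 1ℤ - + suc l)
    ≡⟨ cong₂ _*ℤ_ (fallingℤ-suc x l) (trans (cong (λ z → x +ℤ 1ℤ - z) (ℤₚ.pos-+ 1 l)) (simplify x (+ l))) ⟩
  (x +ℤ 1ℤ) *ℤ fallingℤ x l *ℤ (x - + l)  ≡⟨ ℤₚ.*-assoc (x +ℤ 1ℤ) _ _ ⟩
  (x +ℤ 1ℤ) *ℤ fallingℤ x (suc l) ∎
  where
  open ≡-Reasoning
  simplify : ∀ x l → x +ℤ 1ℤ - (1ℤ +ℤ l) ≡ x - l
  simplify = solve-∀

fallingℤ-Δ : ∀ x l → fallingℤ (x +ℤ 1ℤ) (suc l) ≡ fallingℤ x (suc l) +ℤ + suc l *ℤ fallingℤ x l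
fallingℤ-Δ x l = trans (fallingℤ-suc x l)
  (trans (expand x (+ l) (fallingℤ x l)) (cong (λ z → fallingℤ x (suc l) +ℤ z *ℤ fallingℤ x l) (sym (ℤₚ.pos-+ 1 l))))
  where
  expand : ∀ x l f → (x +ℤ 1ℤ) *ℤ f ≡ f *ℤ (x - l) +ℤ (1ℤ +ℤ l) *ℤ f
  expand = solve-∀

ℤ-induction : ∀ (P : ℤ → Set) → P 0ℤ → (∀ x → P x → P (x +ℤ 1ℤ)) → (∀ x → P (x +ℤ 1ℤ) → P x) → ∀ x → P x
ℤ-induction P P0 up down (+ zero)      = P0
ℤ-induction P P0 up down (+ suc n)     = subst P (cong +_ (ℕₚ.+-comm n 1)) (up (+ n) (ℤ-induction P P0 up down (+ n)))
ℤ-induction P P0 up down -[1+ zero ]   = down -1ℤ P0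
ℤ-induction P P0 up down -[1+ suc n ]  = down -[1+ suc n ] (ℤ-induction P P0 up down -[1+ n ])

-- The difference in x of the falling factorial of length l + 1 is l + 1 times the one of length l,
-- hence divisible by (l + 1)! by induction on l. So divisibility spreads in both directions from x
-- = 0.
!∣fallingℤ : ∀ l x → + (l !) ∣ˢ fallingℤ x l
!∣fallingℤ zero    x = S.∣-refl
!∣fallingℤ (suc l) = ℤ-induction (λ x → + (suc l !) ∣ˢ fallingℤ x (suc l))
  -- At x = 0 the leading factor is -1 + 1 = 0.
  (subst (+ (suc l !) ∣ˢ_) (sym (fallingℤ-suc -1ℤ l)) (divides 0ℤ refl))
  (λ x d → subst (+ (suc l !) ∣ˢ_) (sym (fallingℤ-Δ x l)) (S.∣m∣n⇒∣m+n d (increment x)))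
  (λ x d → S.∣m+n∣n⇒∣m (subst (+ (suc l !) ∣ˢ_) (fallingℤ-Δ x l) d) (increment x))
  where
  increment : ∀ x → + (suc l !) ∣ˢ + suc l *ℤ fallingℤ x l
  increment x = subst (_∣ˢ + suc l *ℤ fallingℤ x l) (sym (ℤₚ.pos-* (suc l) (l !))) (S.*-monoʳ-∣ (+ suc l) (!∣fallingℤ l x))

exact-divℕ : ∀ {n i} → .{{ℕ.NonZero n}} → + n ∣ˢ i → (i divℕ n) *ℤ + n ≡ i
exact-divℕ {suc n} (divides q refl) = cong (_*ℤ + suc n) (*-divℕ n q)

binomℤ-! : ∀ x l → binomℤ x l *ℤ + (l !) ≡ fallingℤ x l
binomℤ-! x l = exact-divℕ {{l ℕₚ.!≢0}} (!∣fallingℤ l x)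

binomℤ-Pascal : ∀ x l → binomℤ (x +ℤ 1ℤ) (suc l) ≡ binomℤ x (suc l) +ℤ binomℤ x l
binomℤ-Pascal x l = ℤₚ.*-cancelʳ-≡ _ _ (+ (suc l !)) {{suc l ℕₚ.!≢0}} (begin
  binomℤ (x +ℤ 1ℤ) (suc l) *ℤ + (suc l !)           ≡⟨ binomℤ-! (x +ℤ 1ℤ) (suc l) ⟩
  fallingℤ (x +ℤ 1ℤ) (suc l)                        ≡⟨ fallingℤ-Δ x l ⟩
  fallingℤ x (suc l) +ℤ + suc l *ℤ fallingℤ x l
    ≡⟨ cong₂ (λ u v → u +ℤ + suc l *ℤ v) (binomℤ-! x (suc l)) (binomℤ-! x l) ⟨
  u *ℤ + (suc l !) +ℤ + suc l *ℤ (v *ℤ + (l !))     ≡⟨ cong (λ z → u *ℤ z +ℤ + suc l *ℤ (v *ℤ + (l !))) (ℤₚ.pos-* (suc l) (l !)) ⟩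
  u *ℤ (+ suc l *ℤ + (l !)) +ℤ + suc l *ℤ (v *ℤ + (l !)) ≡⟨ collect u v (+ suc l) (+ (l !)) ⟩
  (u +ℤ v) *ℤ (+ suc l *ℤ + (l !))                  ≡⟨ cong ((u +ℤ v) *ℤ_) (ℤₚ.pos-* (suc l) (l !)) ⟨
  (u +ℤ v) *ℤ + (suc l !)                           ∎)
  where
  open ≡-Reasoning
  u = binomℤ x (suc l)
  v = binomℤ x l
  collect : ∀ u v s f → u *ℤ (s *ℤ f) +ℤ s *ℤ (v *ℤ f) ≡ (u +ℤ v) *ℤ (s *ℤ f)
  collect = solve-∀

spread : ℕ → (ℤ → ℤ) → ℤ → ℤ
spread m f k = if does (k modℕ m ℕ.≟ 0) then f (k divℕ m) else 0ℤ

spread-on : ∀ m .{{_ : ℕ.NonZero m}} f q → spread m f (q *ℤ + m) ≡ f q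
spread-on (suc m) f q with (q *ℤ + suc m) modℕ suc m | (q *ℤ + suc m) divℕ suc m | divMod-unique m q 0 (s≤s z≤n) (sym (ℤₚ.+-identityˡ (q *ℤ + suc m)))
... | _ | _ | refl , refl = refl

spread-off : ∀ m f q r → 0 < r → r < m → spread m f (+ r +ℤ q *ℤ + m) ≡ 0ℤ
spread-off (suc m) f q r 0<r r<m with (+ r +ℤ q *ℤ + suc m) modℕ suc m | divMod-unique m q r r<m refl
spread-off (suc m) f q (suc r) 0<r r<m | _ | refl , _ = refl

record Residue (m : ℕ) (k : ℤ) : Set where
  constructor residue
  field
    quot  : ℤ
    rem   : ℕ
    rem<m : rem < m
    k≡    : k ≡ + rem +ℤ quot *ℤ + m

residue-of : ∀ m .{{_ : ℕ.NonZero m}} k → Residue m k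
residue-of (suc m) k = residue (k divℕ suc m) (k modℕ suc m) (ℤ÷.n%ℕd<d k (suc m)) (ℤ÷.a≡a%ℕn+[a/ℕn]*n k (suc m))

≗-by-residue : ∀ m .{{_ : ℕ.NonZero m}} {f g : ℤ → ℤ} →
  (∀ q → f (q *ℤ + m) ≡ g (q *ℤ + m)) →
  (∀ q r → 0 < r → r < m → f (+ r +ℤ q *ℤ + m) ≡ g (+ r +ℤ q *ℤ + m)) → ∀ k → f k ≡ g k
≗-by-residue m {f} {g} on off k with residue-of m k
... | residue q zero    r<m refl = subst (λ z → f z ≡ g z) (sym (ℤₚ.+-identityˡ (q *ℤ + m))) (on q)
... | residue q (suc r) r<m refl = off q (suc r) (s≤s z≤n) r<m

spread-cong : ∀ m .{{_ : ℕ.NonZero m}} {f g} → (∀ k → f k ≡ g k) → ∀ k → spread m f k ≡ spread m g k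
spread-cong m {f} {g} h = ≗-by-residue m
  (λ q → trans (spread-on m f q) (trans (h q) (sym (spread-on m g q))))
  (λ q r 0<r r<m → trans (spread-off m f q r 0<r r<m) (sym (spread-off m g q r 0<r r<m)))

-- Splitting the modulus p² as p times p lets powers of Y act on the inner function as powers of δ,
-- which produces the sums for modulus p.
spread-* : ∀ p m .{{_ : ℕ.NonZero p}} .{{_ : ℕ.NonZero m}} .{{_ : ℕ.NonZero (p * m)}} f k → spread (p * m) f k ≡ spread p (spread m f) k
spread-* p m f = ≗-by-residue p on off
  where
  assoc-pos : ∀ q → q *ℤ + m *ℤ + p ≡ q *ℤ + (p * m)
  assoc-pos q = trans (ℤₚ.*-assoc q (+ m) (+ p)) (cong (q *ℤ_) (trans (sym (ℤₚ.pos-* m p)) (cong +_ (ℕₚ.*-comm m p))))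
  regroup : ∀ r s q → + r +ℤ (+ s +ℤ q *ℤ + m) *ℤ + p ≡ + (r + s * p) +ℤ q *ℤ + (p * m)
  regroup r s q = begin
    + r +ℤ (+ s +ℤ q *ℤ + m) *ℤ + p            ≡⟨ expand (+ r) (+ s) (q *ℤ + m) (+ p) ⟩
    + r +ℤ + s *ℤ + p +ℤ q *ℤ + m *ℤ + p       ≡⟨ cong₂ (λ u v → + r +ℤ u +ℤ v) (sym (ℤₚ.pos-* s p)) (assoc-pos q) ⟩
    + (r + s * p) +ℤ q *ℤ + (p * m)             ∎
    where
    open ≡-Reasoning
    expand : ∀ r s x p → r +ℤ (s +ℤ x) *ℤ p ≡ r +ℤ s *ℤ p +ℤ x *ℤ p
    expand = solve-∀
  bound : ∀ {r s} → r < p → s < m → r + s * p < p * m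
  bound {r} {s} r<p s<m = ℕₚ.<-≤-trans (ℕₚ.+-monoˡ-< (s * p) r<p) (subst (suc s * p ≤_) (ℕₚ.*-comm m p) (ℕₚ.*-monoˡ-≤ p s<m))
  off : ∀ q r → 0 < r → r < p → spread (p * m) f (+ r +ℤ q *ℤ + p) ≡ spread p (spread m f) (+ r +ℤ q *ℤ + p)
  off q r 0<r r<p with residue-of m q
  ... | residue q′ s s<m refl = trans
    (trans (cong (spread (p * m) f) (regroup r s q′)) (spread-off (p * m) f q′ (r + s * p) (ℕₚ.<-≤-trans 0<r (ℕₚ.m≤m+n r (s * p))) (bound r<p s<m)))
    (sym (spread-off p (spread m f) q r 0<r r<p))
  on : ∀ q → spread (p * m) f (q *ℤ + p) ≡ spread p (spread m f) (q *ℤ + p)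
  on q = trans (lemma q) (sym (spread-on p (spread m f) q))
    where
    lemma : ∀ q → spread (p * m) f (q *ℤ + p) ≡ spread m f q
    lemma = ≗-by-residue m
      (λ q → trans (cong (spread (p * m) f) (assoc-pos q)) (trans (spread-on (p * m) f q) (sym (spread-on m f q))))
      (λ q s 0<s s<m → trans
        (trans (cong (spread (p * m) f) (trans (sym (ℤₚ.+-identityˡ _)) (regroup 0 s q)))
               (spread-off (p * m) f q (s * p) (ℕₚ.<-≤-trans 0<s (ℕₚ.m≤m*n s p)) (bound (ℕ.>-nonZero⁻¹ p) s<m)))
        (sym (spread-off m f q s 0<s s<m)))

⟦E^⟧ : ∀ n f a → ⟦ E ^ᵒ n ⟧ f a ≡ f (a +ℤ + n)
⟦E^⟧ zero    f a = trans (ℤₚ.*-identityˡ (f a)) (cong f (sym (ℤₚ.+-identityʳ a)))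
⟦E^⟧ (suc n) f a = trans (⟦E^⟧ n f (a +ℤ 1ℤ)) (cong f (ℤₚ.+-assoc a 1ℤ (+ n)))

δ[_] : ℕ → Op
δ[ m ] = K 1ℤ ⊕ K -1ℤ ⊗ E ^ᵒ m

⟦δ[]⟧ : ∀ m f a → ⟦ δ[ m ] ⟧ f a ≡ f a - f (a +ℤ + m)
⟦δ[]⟧ m f a = cong₂ _+ℤ_ (ℤₚ.*-identityˡ (f a)) (trans (ℤₚ.-1*i≡-i _) (cong -_ (⟦E^⟧ m f a)))

δ[]-spread : ∀ m .{{_ : ℕ.NonZero m}} f k → ⟦ δ[ m ] ⟧ (spread m f) k ≡ spread m (⟦ δ ⟧ f) k
δ[]-spread m f k = trans (⟦δ[]⟧ m (spread m f) k) (≗-by-residue m {λ k → spread m f k - spread m f (k +ℤ + m)} on off k)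
  where
  next : ∀ r q m → r +ℤ q *ℤ m +ℤ m ≡ r +ℤ (q +ℤ 1ℤ) *ℤ m
  next = solve-∀
  next₀ : ∀ q m → q *ℤ m +ℤ m ≡ (q +ℤ 1ℤ) *ℤ m
  next₀ = solve-∀
  on : ∀ q → spread m f (q *ℤ + m) - spread m f (q *ℤ + m +ℤ + m) ≡ spread m (⟦ δ ⟧ f) (q *ℤ + m)
  on q = trans (cong₂ _-_ (spread-on m f q) (trans (cong (spread m f) (next₀ q (+ m))) (spread-on m f (q +ℤ 1ℤ))))
               (sym (trans (spread-on m (⟦ δ ⟧ f) q) (⟦δ⟧ f q)))
  off : ∀ q r → 0 < r → r < m → spread m f (+ r +ℤ q *ℤ + m) - spread m f (+ r +ℤ q *ℤ + m +ℤ + m) ≡ spread m (⟦ δ ⟧ f) (+ r +ℤ q *ℤ + m)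
  off q r 0<r r<m = trans
    (cong₂ _-_ (spread-off m f q r 0<r r<m) (trans (cong (spread m f) (next (+ r) q (+ m))) (spread-off m f (q +ℤ 1ℤ) r 0<r r<m)))
    (sym (spread-off m (⟦ δ ⟧ f) q r 0<r r<m))

δ[]^-spread : ∀ m .{{_ : ℕ.NonZero m}} i f k → ⟦ δ[ m ] ^ᵒ i ⟧ (spread m f) k ≡ spread m (⟦ δ ^ᵒ i ⟧ f) k
δ[]^-spread m zero    f k = trans (ℤₚ.*-identityˡ _) (spread-cong m (λ k → sym (ℤₚ.*-identityˡ (f k))) k)
δ[]^-spread m (suc i) f k = trans (⟦⟧-cong δ[ m ] (δ[]^-spread m i f) k) (δ[]-spread m (⟦ δ ^ᵒ i ⟧ f) k)

-- Alternating binomial sums as powers of δ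

binom : ℕ → ℤ → ℤ
binom l k = binomℤ k l

δ-binom-zero : ∀ k → ⟦ δ ⟧ (binom 0) k ≡ 0ℤ
δ-binom-zero k = ⟦δ⟧ (binom 0) k

δ-binom-suc : ∀ l k → ⟦ δ ⟧ (binom (suc l)) k ≡ - binom l k
δ-binom-suc l k = trans (⟦δ⟧ (binom (suc l)) k) (trans (cong (λ z → binomℤ k (suc l) - z) (binomℤ-Pascal k l)) (cancel (binomℤ k (suc l)) (binomℤ k l)))
  where
  cancel : ∀ u v → u - (u +ℤ v) ≡ - v
  cancel = solve-∀

applyUpTo-cong : ∀ {A : Set} n {f g : ℕ → A} → (∀ k → f k ≡ g k) → applyUpTo f n ≡ applyUpTo g n
applyUpTo-cong zero    h = refl
applyUpTo-cong (suc n) h = cong₂ _∷_ (h 0) (applyUpTo-cong n (λ k → h (suc k)))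

-- The length N may exceed n + 1 because Pascal's rule splits one sum into two whose natural lengths
-- differ; the surplus terms vanish. The summand `g` is tied to `f` only pointwise, so that shifting
-- the index by one merely moves the base point a to a + 1.
alternatingSum : ∀ n N (g : ℕ → ℤ) → n < N → ∀ f a → (∀ k → g k ≡ f (a +ℤ + k)) →
  sumℤ (applyUpTo (λ k → (-1ℤ ^ k) *ℤ + (n C k) *ℤ g k) N) ≡ ⟦ δ ^ᵒ n ⟧ f a
alternatingSum zero (suc N) g _ f a g≡f = begin
  1ℤ *ℤ g 0 +ℤ sumℤ (applyUpTo (λ k → (-1ℤ ^ suc k) *ℤ 0ℤ *ℤ g (suc k)) N)
    ≡⟨ cong (1ℤ *ℤ g 0 +ℤ_) (zeros N (λ k → -1ℤ ^ suc k) (λ k → g (suc k))) ⟩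
  1ℤ *ℤ g 0 +ℤ 0ℤ  ≡⟨ ℤₚ.+-identityʳ _ ⟩
  1ℤ *ℤ g 0        ≡⟨ cong (1ℤ *ℤ_) (trans (g≡f 0) (cong f (ℤₚ.+-identityʳ a))) ⟩
  1ℤ *ℤ f a        ∎
  where
  open ≡-Reasoning
  zeros : ∀ N (c g : ℕ → ℤ) → sumℤ (applyUpTo (λ k → c k *ℤ 0ℤ *ℤ g k) N) ≡ 0ℤ
  zeros zero    c g = refl
  zeros (suc N) c g = cong₂ _+ℤ_ (cong (_*ℤ g 0) (ℤₚ.*-zeroʳ (c 0))) (zeros N (λ k → c (suc k)) (λ k → g (suc k)))
alternatingSum (suc n) (suc N) g (s≤s n<N) f a g≡f = begin
  t₀ +ℤ sumℤ (applyUpTo (λ k → (-1ℤ ^ suc k) *ℤ + (suc n C suc k) *ℤ g (suc k)) N)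
    ≡⟨ cong (t₀ +ℤ_) (split N (λ k → -1ℤ ^ k) (n C_) (λ k → n C suc k) (λ k → suc n C suc k) (λ k → g (suc k)) (λ k → nCk+nC[k+1]≡[n+1]C[k+1] n k)) ⟩
  t₀ +ℤ (T - U)
    ≡⟨ ℤₚ.+-assoc t₀ T (- U) ⟨
  (t₀ +ℤ T) - U
    ≡⟨ cong₂ _-_ (alternatingSum n (suc N) g (ℕₚ.m<n⇒m<1+n n<N) f a g≡f)
                 (alternatingSum n N (λ k → g (suc k)) n<N f (a +ℤ 1ℤ) (λ k → trans (g≡f (suc k)) (cong f (sym (ℤₚ.+-assoc a 1ℤ (+ k)))))) ⟩
  ⟦ δ ^ᵒ n ⟧ f a - ⟦ δ ^ᵒ n ⟧ f (a +ℤ 1ℤ)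
    ≡⟨ ⟦δ⟧ (⟦ δ ^ᵒ n ⟧ f) a ⟨
  ⟦ δ ^ᵒ suc n ⟧ f a ∎
  where
  open ≡-Reasoning
  t₀ = 1ℤ *ℤ g 0
  T = sumℤ (applyUpTo (λ k → (-1ℤ ^ suc k) *ℤ + (n C suc k) *ℤ g (suc k)) N)
  U = sumℤ (applyUpTo (λ k → (-1ℤ ^ k) *ℤ + (n C k) *ℤ g (suc k)) N)
  step : ∀ s x y g t u → -1ℤ *ℤ s *ℤ (x +ℤ y) *ℤ g +ℤ (t - u) ≡ (-1ℤ *ℤ s *ℤ y *ℤ g +ℤ t) - (s *ℤ x *ℤ g +ℤ u)
  step = solve-∀
  split : ∀ N (s : ℕ → ℤ) (b c d : ℕ → ℕ) (h : ℕ → ℤ) → (∀ k → b k + c k ≡ d k) →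
    sumℤ (applyUpTo (λ k → -1ℤ *ℤ s k *ℤ + d k *ℤ h k) N)
      ≡ sumℤ (applyUpTo (λ k → -1ℤ *ℤ s k *ℤ + c k *ℤ h k) N) - sumℤ (applyUpTo (λ k → s k *ℤ + b k *ℤ h k) N)
  split zero    s b c d h e = refl
  split (suc N) s b c d h e = trans
    (cong₂ (λ u v → -1ℤ *ℤ s 0 *ℤ u *ℤ h 0 +ℤ v) (sym (cong +_ (e 0)))
      (split N (λ k → s (suc k)) (λ k → b (suc k)) (λ k → c (suc k)) (λ k → d (suc k)) (λ k → h (suc k)) (λ k → e (suc k))))
    (step (s 0) (+ b 0) (+ c 0) (h 0) _ _)

rawψ-δ : ∀ l p b n r → rawψ l p b n r ≡ ⟦ δ ^ᵒ n ⟧ (spread (p ℕ.^ b) (binom l)) (- r)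
rawψ-δ l p b n r = trans
  (cong sumℤ (trans (Listₚ.map-upTo term (suc n)) (applyUpTo-cong (suc n) factor)))
  (alternatingSum n (suc n) (λ k → spread m (binom l) (+ k - r)) ℕₚ.≤-refl (spread m (binom l)) (- r)
    (λ k → cong (spread m (binom l)) (ℤₚ.+-comm (+ k) (- r))))
  where
  m = p ℕ.^ b
  term term′ : ℕ → ℤ
  term k = if does ((+ k - r) modℕ m ℕ.≟ 0) then (-1ℤ ^ k) *ℤ + (n C k) *ℤ binomℤ ((+ k - r) divℕ m) l else 0ℤ
  term′ k = (-1ℤ ^ k) *ℤ + (n C k) *ℤ spread m (binom l) (+ k - r)
  factor : ∀ k → term k ≡ term′ k
  factor k with does ((+ k - r) modℕ m ℕ.≟ 0)
  ... | true  = refl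
  ... | false = sym (ℤₚ.*-zeroʳ ((-1ℤ ^ k) *ℤ + (n C k)))

-- The p-th power of δ

open import Algebra.Properties.Monoid.Sum Opᴿ.+-monoid using (sum; sum-init-last)
open import Algebra.Properties.Monoid.Mult Opᴿ.+-monoid using () renaming (_×_ to _×ᵒ_)
open import Algebra.Properties.CommutativeSemiring.Exp Opᴿ.commutativeSemiring using (^-distrib-*)
import Algebra.Properties.CommutativeSemiring.Binomial Opᴿ.commutativeSemiring as Binomial

absorption : ∀ n k → suc k * (suc n C suc k) ≡ suc n * (n C k)
absorption n       zero    = trans (cong (1 *_) (nC1≡n (suc n))) (ℕₚ.*-comm 1 (suc n))
absorption zero    (suc k) = trans (cong (suc (suc k) *_) (k>n⇒nCk≡0 {1} {suc (suc k)} (s≤s (s≤s z≤n)))) (ℕₚ.*-zeroʳ (suc (suc k)))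
absorption (suc n) (suc k) = begin
  suc (suc k) * (suc (suc n) C suc (suc k))   ≡⟨ cong (suc (suc k) *_) (nCk+nC[k+1]≡[n+1]C[k+1] (suc n) (suc k)) ⟨
  suc (suc k) * (x + y)                       ≡⟨ expand (suc k) x y ⟩
  suc k * x + x + suc (suc k) * y             ≡⟨ cong₂ (λ u v → u + x + v) (absorption n k) (absorption n (suc k)) ⟩
  suc n * (n C k) + x + suc n * (n C suc k)   ≡⟨ collect (suc n) (n C k) x (n C suc k) ⟩
  suc n * ((n C k) + (n C suc k)) + x         ≡⟨ cong (λ z → suc n * z + x) (nCk+nC[k+1]≡[n+1]C[k+1] n k) ⟩
  suc n * x + x                               ≡⟨ ℕₚ.+-comm (suc n * x) x ⟩
  suc (suc n) * x                             ∎
  where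
  open ≡-Reasoning
  x = suc n C suc k
  y = suc n C suc (suc k)
  expand : ∀ k x y → suc k * (x + y) ≡ k * x + x + suc k * y
  expand = ℕ-solve-∀
  collect : ∀ n a x b → n * a + x + n * b ≡ n * (a + b) + x
  collect = ℕ-solve-∀

<⇒∤ : ∀ {p k} → 0 < k → k < p → ¬ p ∣ k
<⇒∤ {p} {suc k} _ k<p p∣k = contradiction (∣ₚ.∣⇒≤ p∣k) (ℕₚ.<⇒≱ k<p)

prime∣C : ∀ {p} → Prime p → ∀ {k} → 0 < k → k < p → p ∣ p C k
prime∣C {suc p} p-prime {suc k} 0<k k<p
  with euclidsLemma (suc k) (suc p C suc k) p-prime (subst (suc p ∣_) (sym (absorption p k)) (∣ₚ.m∣m*n (p C k)))
... | inj₁ p∣k = contradiction p∣k (<⇒∤ 0<k k<p)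
... | inj₂ p∣C = p∣C

-1^-cases : ∀ n → (-1ℤ ^ n ≡ 1ℤ × 2 ∣ n) ⊎ -1ℤ ^ n ≡ -1ℤ
-1^-cases zero          = inj₁ (refl , 2 ∣ₚ.∣0)
-1^-cases (suc zero)    = inj₂ refl
-1^-cases (suc (suc n)) with -1^-cases n
... | inj₁ (eq , 2∣n) = inj₁ (cong (λ z → -1ℤ *ℤ (-1ℤ *ℤ z)) eq , ∣ₚ.∣m∣n⇒∣m+n (∣ₚ.∣-refl {2}) 2∣n)
... | inj₂ eq         = inj₂ (cong (λ z → -1ℤ *ℤ (-1ℤ *ℤ z)) eq)

odd-prime-sign : ∀ {p} → Prime p → p ≢ 2 → -1ℤ ^ p ≡ -1ℤ
odd-prime-sign {p} p-prime p≢2 with -1^-cases p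
... | inj₂ eq = eq
... | inj₁ (_ , 2∣p) with prime⇒irreducible p-prime 2∣p
...   | inj₂ 2≡p = contradiction (sym 2≡p) p≢2

×ᵒ-K : ∀ c P → c ×ᵒ P ≋ K (+ c) ⊗ P
×ᵒ-K zero    P = mk≋ λ f a → refl
×ᵒ-K (suc c) P = mk≋ λ f a → trans (cong (⟦ P ⟧ f a +ℤ_) (at (×ᵒ-K c P) f a)) (sym (ℤₚ.suc-* (+ c) (⟦ P ⟧ f a)))

sum-factor : ∀ R n (t : Fin n → Op) → (∀ i → ∃[ Q ] t i ≋ R ⊗ Q) → ∃[ Q ] sum t ≋ R ⊗ Q
sum-factor R zero    t h = K 0ℤ , Opᴿ.sym (Opᴿ.zeroʳ R)
sum-factor R (suc n) t h with h zero | sum-factor R n (λ i → t (suc i)) (λ i → h (suc i))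
... | Q , e | Q′ , e′ = Q ⊕ Q′ , Opᴿ.trans (Opᴿ.+-cong e e′) (Opᴿ.sym (Opᴿ.distribˡ R Q Q′))

K^ : ∀ c n → K c ^ᵒ n ≋ K (c ^ n)
K^ c zero    = Opᴿ.refl
K^ c (suc n) = Opᴿ.trans (Opᴿ.*-congˡ (K^ c n)) (mk≋ λ f a → sym (ℤₚ.*-assoc c (c ^ n) (f a)))

1^ : ∀ n → K 1ℤ ^ᵒ n ≋ K 1ℤ
1^ n = Opᴿ.trans (K^ 1ℤ n) (Opᴿ.reflexive (cong K (ℤₚ.^-zeroˡ n)))

-- The middle terms of the binomial expansion of (1 + P)^p are divisible by p and, from the quadratic one on, by P².
[P+1]^p : ∀ {p} → Prime p → ∀ P →
  ∃[ Q ] (P ⊕ K 1ℤ) ^ᵒ p ≋ K 1ℤ ⊕ (K (+ p) ⊗ P ⊕ (K (+ p) ⊗ P ⊗ P ⊗ Q ⊕ P ^ᵒ p))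
[P+1]^p {0} p-prime = contradiction p-prime λ ()
[P+1]^p {1} p-prime = contradiction p-prime λ ()
[P+1]^p {p@(suc (suc n))} p-prime P = Q , (begin
  (P ⊕ K 1ℤ) ^ᵒ p
    ≈⟨ Binomial.theorem p P (K 1ℤ) ⟩
  term zero ⊕ (term (suc zero) ⊕ sum tail₂)
    ≈⟨ Opᴿ.+-cong (term≋ zero) (Opᴿ.+-cong (term≋ (suc zero)) (sum-init-last tail₂)) ⟩
  K (+ 1) ⊗ K 1ℤ ⊕ (K (+ (p C 1)) ⊗ (P ⊗ K 1ℤ) ⊕ (sum (init tail₂) ⊕ last tail₂))
    ≈⟨ Opᴿ.+-cong (Opᴿ.*-identityʳ (K 1ℤ)) (Opᴿ.+-cong (Opᴿ.*-cong (Opᴿ.reflexive (cong (λ c → K (+ c)) (nC1≡n p))) (Opᴿ.*-identityʳ P))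
         (Opᴿ.+-cong (proj₂ middle) last≋)) ⟩
  K 1ℤ ⊕ (K (+ p) ⊗ P ⊕ (K (+ p) ⊗ P ⊗ P ⊗ Q ⊕ P ^ᵒ p)) ∎)
  where
  open ≋-Reasoning
  term : Fin (suc p) → Op
  term = Binomial.binomialTerm P (K 1ℤ) p
  tail₂ : Fin (suc n) → Op
  tail₂ i = term (suc (suc i))
  term≋ : ∀ i → term i ≋ K (+ (p C toℕ i)) ⊗ P ^ᵒ toℕ i
  term≋ i = begin
    (p C k) ×ᵒ (P ^ᵒ k ⊗ K 1ℤ ^ᵒ (p ∸ k))      ≈⟨ ×ᵒ-K (p C k) _ ⟩
    K (+ (p C k)) ⊗ (P ^ᵒ k ⊗ K 1ℤ ^ᵒ (p ∸ k)) ≈⟨ Opᴿ.*-congˡ {K (+ (p C k))} (Opᴿ.*-congˡ {P ^ᵒ k} (1^ (p ∸ k))) ⟩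
    K (+ (p C k)) ⊗ (P ^ᵒ k ⊗ K 1ℤ)            ≈⟨ Opᴿ.*-congˡ {K (+ (p C k))} (Opᴿ.*-identityʳ (P ^ᵒ k)) ⟩
    K (+ (p C k)) ⊗ P ^ᵒ k                     ∎
    where k = toℕ i
  divisible : ∀ k → k < n → ∃[ Q ] K (+ (p C suc (suc k))) ⊗ P ^ᵒ suc (suc k) ≋ K (+ p) ⊗ P ⊗ P ⊗ Q
  divisible k k<n with prime∣C p-prime {suc (suc k)} (s≤s z≤n) (s≤s (s≤s k<n))
  ... | ∣ₚ.divides c eq = K (+ c) ⊗ P ^ᵒ k , (begin
    K (+ (p C suc (suc k))) ⊗ P ^ᵒ suc (suc k)
      ≈⟨ Opᴿ.*-congʳ {P ^ᵒ suc (suc k)} (mk≋ λ f a → trans (cong (_*ℤ f a) (trans (cong +_ eq) (ℤₚ.pos-* c p))) (ℤₚ.*-assoc (+ c) (+ p) (f a))) ⟩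
    K (+ c) ⊗ K (+ p) ⊗ (P ⊗ (P ⊗ P ^ᵒ k))
      ≈⟨ solveᵒ 4 (λ c p x y → c :* p :* (x :* (x :* y)) := p :* x :* x :* (c :* y)) Opᴿ.refl (K (+ c)) (K (+ p)) P (P ^ᵒ k) ⟩
    K (+ p) ⊗ P ⊗ P ⊗ (K (+ c) ⊗ P ^ᵒ k) ∎)
  middle : ∃[ Q ] sum (init tail₂) ≋ K (+ p) ⊗ P ⊗ P ⊗ Q
  middle = sum-factor (K (+ p) ⊗ P ⊗ P) n (init tail₂) λ i →
    let Q , e = divisible (toℕ i) (Finₚ.toℕ<n i) in
    Q , Opᴿ.trans (term≋ (suc (suc (inject₁ i))))
          (Opᴿ.trans (Opᴿ.reflexive (cong (λ k → K (+ (p C suc (suc k))) ⊗ P ^ᵒ suc (suc k)) (Finₚ.toℕ-inject₁ i))) e)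
  Q = proj₁ middle
  last≋ : last tail₂ ≋ P ^ᵒ p
  last≋ = begin
    term (suc (suc (fromℕ n)))
      ≈⟨ term≋ (suc (suc (fromℕ n))) ⟩
    K (+ (p C toℕ (fromℕ p))) ⊗ P ^ᵒ toℕ (fromℕ p)
      ≡⟨ cong (λ k → K (+ (p C k)) ⊗ P ^ᵒ k) (Finₚ.toℕ-fromℕ p) ⟩
    K (+ (p C p)) ⊗ P ^ᵒ p
      ≡⟨ cong (λ c → K (+ c) ⊗ P ^ᵒ p) (nCn≡1 p) ⟩
    K 1ℤ ⊗ P ^ᵒ p
      ≈⟨ Opᴿ.*-identityˡ (P ^ᵒ p) ⟩
    P ^ᵒ p ∎

-- Expand E^p = (1 - δ)^p. For odd p its last term is -δ^p, and the equation can be solved for δ^p.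
δ^p : ∀ {p} → Prime p → ∃[ Q ] δ ^ᵒ p ≋ δ[ p ] ⊕ K (+ p) ⊗ (δ ⊗ (δ ⊗ Q ⊕ K -1ℤ))
δ^p {p} p-prime with p ℕ.≟ 2
-- For p = 2 the last term is +δ², so Y = 2δ - δ². Then δ² - Y = 2δ² - 2δ = 2δ(δ - 1), and Q = 1.
... | yes refl = K 1ℤ , solveᵒ 1 (λ e →
      (con 1ℤ :+ con -1ℤ :* e) :* ((con 1ℤ :+ con -1ℤ :* e) :* con 1ℤ) :=
      (con 1ℤ :+ con -1ℤ :* (e :* (e :* con 1ℤ))) :+
      con (+ 2) :* ((con 1ℤ :+ con -1ℤ :* e) :* ((con 1ℤ :+ con -1ℤ :* e) :* con 1ℤ :+ con -1ℤ))) Opᴿ.refl E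
... | no p≢2 = Q , (begin
  δ ^ᵒ p
    ≈⟨ solveᵒ 5 (λ x k z q w → z :=
          con 1ℤ :+ con -1ℤ :* (con 1ℤ :+ (k :* (con -1ℤ :* x) :+ (k :* (con -1ℤ :* x) :* (con -1ℤ :* x) :* q :+ con -1ℤ :* z)))
          :+ k :* (x :* (x :* q :+ con -1ℤ))) Opᴿ.refl δ (K (+ p)) (δ ^ᵒ p) Q E ⟩
  K 1ℤ ⊕ K -1ℤ ⊗ (K 1ℤ ⊕ (K (+ p) ⊗ P ⊕ (K (+ p) ⊗ P ⊗ P ⊗ Q ⊕ K -1ℤ ⊗ δ ^ᵒ p))) ⊕ K (+ p) ⊗ (δ ⊗ (δ ⊗ Q ⊕ K -1ℤ))
    ≈⟨ Opᴿ.+-congʳ (Opᴿ.+-congˡ {K 1ℤ} (Opᴿ.*-congˡ {K -1ℤ} E^p)) ⟨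
  δ[ p ] ⊕ K (+ p) ⊗ (δ ⊗ (δ ⊗ Q ⊕ K -1ℤ)) ∎)
  where
  open ≋-Reasoning
  P = K -1ℤ ⊗ δ
  expansion = [P+1]^p p-prime P
  Q = proj₁ expansion
  P^p : P ^ᵒ p ≋ K -1ℤ ⊗ δ ^ᵒ p
  P^p = Opᴿ.trans (^-distrib-* (K -1ℤ) δ p)
    (Opᴿ.*-congʳ {δ ^ᵒ p} (Opᴿ.trans (K^ -1ℤ p) (Opᴿ.reflexive (cong K (odd-prime-sign p-prime p≢2)))))
  E^p : E ^ᵒ p ≋ K 1ℤ ⊕ (K (+ p) ⊗ P ⊕ (K (+ p) ⊗ P ⊗ P ⊗ Q ⊕ K -1ℤ ⊗ δ ^ᵒ p))
  E^p = begin
    E ^ᵒ p           ≈⟨ ^-congˡ p (solveᵒ 1 (λ e → e := con -1ℤ :* (con 1ℤ :+ con -1ℤ :* e) :+ con 1ℤ) Opᴿ.refl E) ⟩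
    (P ⊕ K 1ℤ) ^ᵒ p  ≈⟨ proj₂ expansion ⟩
    K 1ℤ ⊕ (K (+ p) ⊗ P ⊕ (K (+ p) ⊗ P ⊗ P ⊗ Q ⊕ P ^ᵒ p))
      ≈⟨ Opᴿ.+-congˡ {K 1ℤ} (Opᴿ.+-congˡ {K (+ p) ⊗ P} (Opᴿ.+-congˡ {K (+ p) ⊗ P ⊗ P ⊗ Q} P^p)) ⟩
    K 1ℤ ⊕ (K (+ p) ⊗ P ⊕ (K (+ p) ⊗ P ⊗ P ⊗ Q ⊕ K -1ℤ ⊗ δ ^ᵒ p)) ∎

-- Sums modulo p

∣-resp : ∀ {m x y} → x ≡ y → m ∣ˢ x → m ∣ˢ y
∣-resp {m} = subst (m ∣ˢ_)

⟦⟧-∣ : ∀ P {m f} → (∀ a → m ∣ˢ f a) → ∀ a → m ∣ˢ ⟦ P ⟧ f a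
⟦⟧-∣ E       h a = h (a +ℤ 1ℤ)
⟦⟧-∣ (K c)   h a = S.∣n⇒∣m*n c (h a)
⟦⟧-∣ (P ⊕ Q) h a = S.∣m∣n⇒∣m+n (⟦⟧-∣ P h a) (⟦⟧-∣ Q h a)
⟦⟧-∣ (P ⊗ Q) h   = ⟦⟧-∣ P (⟦⟧-∣ Q h)

⟦⟧-0 : ∀ P a → ⟦ P ⟧ (λ _ → 0ℤ) a ≡ 0ℤ
⟦⟧-0 P a = ⟦⟧-* P 0ℤ (λ _ → 0ℤ) a

⟦⟧-neg : ∀ P f a → ⟦ P ⟧ (λ b → - f b) a ≡ - ⟦ P ⟧ f a
⟦⟧-neg P f a = trans (⟦⟧-cong P (λ b → sym (ℤₚ.-1*i≡-i (f b))) a) (trans (⟦⟧-* P -1ℤ f a) (ℤₚ.-1*i≡-i _))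

δ^-single : ∀ n t f a → (∀ k → k ≤ n → k ≢ t → f (a +ℤ + k) ≡ 0ℤ) →
  ⟦ δ ^ᵒ n ⟧ f a ≡ (-1ℤ ^ t) *ℤ + (n C t) *ℤ f (a +ℤ + t)
δ^-single zero zero f a h = cong (λ z → 1ℤ *ℤ f z) (sym (ℤₚ.+-identityʳ a))
δ^-single zero (suc t) f a h = trans
  (cong (1ℤ *ℤ_) (trans (cong f (sym (ℤₚ.+-identityʳ a))) (h 0 z≤n (λ ()))))
  (sym (cong (_*ℤ f (a +ℤ + suc t)) (ℤₚ.*-zeroʳ (-1ℤ ^ suc t))))
δ^-single (suc n) t f a h = begin
  ⟦ δ ^ᵒ suc n ⟧ f a                              ≡⟨ ⟦δ⟧ (⟦ δ ^ᵒ n ⟧ f) a ⟩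
  ⟦ δ ^ᵒ n ⟧ f a - ⟦ δ ^ᵒ n ⟧ f (a +ℤ 1ℤ)          ≡⟨ cong (_- ⟦ δ ^ᵒ n ⟧ f (a +ℤ 1ℤ)) (δ^-single n t f a (λ k k≤n → h k (ℕₚ.m≤n⇒m≤1+n k≤n))) ⟩
  (-1ℤ ^ t) *ℤ + (n C t) *ℤ f (a +ℤ + t) - ⟦ δ ^ᵒ n ⟧ f (a +ℤ 1ℤ) ≡⟨ shifted t h ⟩
  (-1ℤ ^ t) *ℤ + (suc n C t) *ℤ f (a +ℤ + t) ∎
  where
  open ≡-Reasoning
  next : ∀ k → f (a +ℤ 1ℤ +ℤ + k) ≡ f (a +ℤ + suc k)
  next k = cong f (ℤₚ.+-assoc a 1ℤ (+ k))
  collect : ∀ s x y v → -1ℤ *ℤ s *ℤ y *ℤ v - s *ℤ x *ℤ v ≡ -1ℤ *ℤ s *ℤ (x +ℤ y) *ℤ v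
  collect = solve-∀
  shifted : ∀ t → (∀ k → k ≤ suc n → k ≢ t → f (a +ℤ + k) ≡ 0ℤ) →
    (-1ℤ ^ t) *ℤ + (n C t) *ℤ f (a +ℤ + t) - ⟦ δ ^ᵒ n ⟧ f (a +ℤ 1ℤ) ≡ (-1ℤ ^ t) *ℤ + (suc n C t) *ℤ f (a +ℤ + t)
  shifted zero h = trans (cong (λ z → 1ℤ *ℤ f (a +ℤ 0ℤ) - z) vanishes) (ℤₚ.+-identityʳ _)
    where
    vanishes : ⟦ δ ^ᵒ n ⟧ f (a +ℤ 1ℤ) ≡ 0ℤ
    vanishes = trans (δ^-single n 0 f (a +ℤ 1ℤ) (λ k k≤n _ → trans (next k) (h (suc k) (s≤s k≤n) λ ())))
                     (cong (1ℤ *ℤ_) (trans (next 0) (h 1 (s≤s z≤n) λ ())))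
  shifted (suc t) h = begin
    -1ℤ *ℤ s *ℤ + (n C suc t) *ℤ v - ⟦ δ ^ᵒ n ⟧ f (a +ℤ 1ℤ)
      ≡⟨ cong (λ z → -1ℤ *ℤ s *ℤ + (n C suc t) *ℤ v - z)
           (trans (δ^-single n t f (a +ℤ 1ℤ) (λ k k≤n k≢t → trans (next k) (h (suc k) (s≤s k≤n) λ e → k≢t (ℕₚ.suc-injective e))))
                  (cong (s *ℤ + (n C t) *ℤ_) (next t))) ⟩
    -1ℤ *ℤ s *ℤ + (n C suc t) *ℤ v - s *ℤ + (n C t) *ℤ v
      ≡⟨ collect s (+ (n C t)) (+ (n C suc t)) v ⟩
    -1ℤ *ℤ s *ℤ + ((n C t) + (n C suc t)) *ℤ v
      ≡⟨ cong (λ z → -1ℤ *ℤ s *ℤ + z *ℤ v) (nCk+nC[k+1]≡[n+1]C[k+1] n t) ⟩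
    -1ℤ *ℤ s *ℤ + (suc n C suc t) *ℤ v ∎
    where
    s = -1ℤ ^ t
    v = f (a +ℤ + suc t)

-- A window of p + 1 consecutive integers holds two multiples of p exactly when it starts at one.
-- The last hypothesis excludes this: either t > 0, or the far end k = p is not reached.
spread-off-shift : ∀ p f u {k t} → k ≤ p → t < p → k ≢ t → 0 < t ⊎ k < p → spread p f (u *ℤ + p - + t +ℤ + k) ≡ 0ℤ
spread-off-shift p f u {k} {t} k≤p t<p k≢t strict with ℕₚ.<-cmp k t
... | tri≈ _ k≡t _ = contradiction k≡t k≢t
... | tri> _ _ t<k = trans (cong (spread p f) reduce)
    (spread-off p f u (k ∸ t) (ℕₚ.m<n⇒0<n∸m t<k) ([k∸t]<p strict))
  where
  [k∸t]<p : 0 < t ⊎ k < p → k ∸ t < p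
  [k∸t]<p (inj₁ 0<t) = ℕₚ.<-≤-trans (ℕₚ.∸-monoʳ-< 0<t (ℕₚ.<⇒≤ t<k)) k≤p
  [k∸t]<p (inj₂ k<p) = ℕₚ.≤-<-trans (ℕₚ.m∸n≤m k t) k<p
  rearrange : ∀ x t d → x - t +ℤ (d +ℤ t) ≡ d +ℤ x
  rearrange = solve-∀
  reduce : u *ℤ + p - + t +ℤ + k ≡ + (k ∸ t) +ℤ u *ℤ + p
  reduce = trans (cong (λ z → u *ℤ + p - + t +ℤ + z) (sym (ℕₚ.m∸n+n≡m (ℕₚ.<⇒≤ t<k)))) (rearrange (u *ℤ + p) (+ t) (+ (k ∸ t)))
... | tri< k<t _ _ = trans (cong (spread p f) reduce)
    (spread-off p f (u - 1ℤ) (k + (p ∸ t)) (ℕₚ.<-≤-trans (ℕₚ.m<n⇒0<n∸m t<p) (ℕₚ.m≤n+m (p ∸ t) k))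
      (subst (k + (p ∸ t) <_) (ℕₚ.m+[n∸m]≡n (ℕₚ.<⇒≤ t<p)) (ℕₚ.+-monoˡ-< (p ∸ t) k<t)))
  where
  rearrange : ∀ u t k q → u *ℤ (t +ℤ q) - t +ℤ k ≡ k +ℤ q +ℤ (u - 1ℤ) *ℤ (t +ℤ q)
  rearrange = solve-∀
  reduce : u *ℤ + p - + t +ℤ + k ≡ + (k + (p ∸ t)) +ℤ (u - 1ℤ) *ℤ + p
  reduce = subst (λ z → u *ℤ + z - + t +ℤ + k ≡ + (k + (p ∸ t)) +ℤ (u - 1ℤ) *ℤ + z)
    (ℕₚ.m+[n∸m]≡n (ℕₚ.<⇒≤ t<p)) (rearrange u (+ t) (+ k) (+ (p ∸ t)))

δ^-spread : ∀ p .{{_ : ℕ.NonZero p}} n t f u → n ≤ p → t < p → 0 < t ⊎ n < p →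
  ⟦ δ ^ᵒ n ⟧ (spread p f) (u *ℤ + p - + t) ≡ (-1ℤ ^ t) *ℤ + (n C t) *ℤ f u
δ^-spread p n t f u n≤p t<p strict = trans
  (δ^-single n t (spread p f) (u *ℤ + p - + t)
    (λ k k≤n k≢t → spread-off-shift p f u (ℕₚ.≤-trans k≤n n≤p) t<p k≢t (weaken k≤n strict)))
  (cong ((-1ℤ ^ t) *ℤ + (n C t) *ℤ_) (trans (cong (spread p f) (cancel (u *ℤ + p) (+ t))) (spread-on p f u)))
  where
  weaken : ∀ {k} → k ≤ n → 0 < t ⊎ n < p → 0 < t ⊎ k < p
  weaken k≤n (inj₁ 0<t) = inj₁ 0<t
  weaken k≤n (inj₂ n<p) = inj₂ (ℕₚ.≤-<-trans k≤n n<p)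
  cancel : ∀ x t → x - t +ℤ t ≡ x
  cancel = solve-∀

module PrimePowers {c : ℕ} (p-prime : Prime (suc c)) where

  p : ℕ
  p = suc c

  0<c : 0 < c
  0<c = positive p-prime
    where
    positive : ∀ {c} → Prime (suc c) → 0 < c
    positive {zero}  ()
    positive {suc c} _ = s≤s z≤n

  Q H : Op
  Q = proj₁ (δ^p p-prime)
  H = δ ⊗ Q ⊕ K -1ℤ

  T : ℕ → ℕ → ℤ → ℤ
  T l n = ⟦ δ ^ᵒ n ⟧ (spread p (binom l))

  δ^[n+p] : ∀ n f a → ⟦ δ ^ᵒ (n + p) ⟧ f a ≡ ⟦ δ ^ᵒ n ⟧ (⟦ δ[ p ] ⟧ f) a +ℤ + p *ℤ ⟦ H ⟧ (⟦ δ ^ᵒ suc n ⟧ f) a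
  δ^[n+p] n = at (begin
    δ ^ᵒ (n + p)
      ≈⟨ ^-homo-* δ n p ⟩
    δ ^ᵒ n ⊗ δ ^ᵒ p
      ≈⟨ Opᴿ.*-congˡ {δ ^ᵒ n} (proj₂ (δ^p p-prime)) ⟩
    δ ^ᵒ n ⊗ (δ[ p ] ⊕ K (+ p) ⊗ (δ ⊗ H))
      ≈⟨ solveᵒ 5 (λ d x y k h → x :* (y :+ k :* (d :* h)) := x :* y :+ k :* (h :* (d :* x))) Opᴿ.refl δ (δ ^ᵒ n) δ[ p ] (K (+ p)) H ⟩
    δ ^ᵒ n ⊗ δ[ p ] ⊕ K (+ p) ⊗ (H ⊗ δ ^ᵒ suc n) ∎)
    where open ≋-Reasoning

  δ[p]-spread-binom-zero : ∀ a → ⟦ δ[ p ] ⟧ (spread p (binom 0)) a ≡ 0ℤ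
  δ[p]-spread-binom-zero a = trans (δ[]-spread p (binom 0) a)
    (trans (spread-cong p δ-binom-zero a) (≗-by-residue p {g = λ _ → 0ℤ} (spread-on p (λ _ → 0ℤ)) (spread-off p (λ _ → 0ℤ)) a))

  δ[p]-spread-binom-suc : ∀ l a → ⟦ δ[ p ] ⟧ (spread p (binom (suc l))) a ≡ - spread p (binom l) a
  δ[p]-spread-binom-suc l a = trans (δ[]-spread p (binom (suc l)) a) (≗-by-residue p {g = λ a → - spread p (binom l) a}
    (λ q → trans (spread-on p (⟦ δ ⟧ (binom (suc l))) q) (trans (δ-binom-suc l q) (cong -_ (sym (spread-on p (binom l) q)))))
    (λ q r 0<r r<p → trans (spread-off p (⟦ δ ⟧ (binom (suc l))) q r 0<r r<p) (cong -_ (sym (spread-off p (binom l) q r 0<r r<p)))) a)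

  T-zero-+p : ∀ n a → T 0 (n + p) a ≡ + p *ℤ ⟦ H ⟧ (T 0 (suc n)) a
  T-zero-+p n a = trans (δ^[n+p] n _ a) (trans
    (cong (_+ℤ + p *ℤ ⟦ H ⟧ (T 0 (suc n)) a) (trans (⟦⟧-cong (δ ^ᵒ n) δ[p]-spread-binom-zero a) (⟦⟧-0 (δ ^ᵒ n) a)))
    (ℤₚ.+-identityˡ _))

  T-suc-+p : ∀ l n a → T (suc l) (n + p) a ≡ - T l n a +ℤ + p *ℤ ⟦ H ⟧ (T (suc l) (suc n)) a
  T-suc-+p l n a = trans (δ^[n+p] n _ a)
    (cong (_+ℤ + p *ℤ ⟦ H ⟧ (T (suc l) (suc n)) a)
      (trans (⟦⟧-cong (δ ^ᵒ n) (δ[p]-spread-binom-suc l) a) (⟦⟧-neg (δ ^ᵒ n) (spread p (binom l)) a)))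

  T-suc : ∀ l n a → T l (suc n) a ≡ T l n a - T l n (a +ℤ 1ℤ)
  T-suc l n a = ⟦δ⟧ (T l n) a

  1∣ : ∀ x → 1ℤ ∣ˢ x
  1∣ x = divides x (sym (ℤₚ.*-identityʳ x))

  -- Both terms of the recurrence keep the bound: lowering n by p pays for lowering l by one, and
  -- lowering n by p - 1 pays for the factor p.
  T-∣ : ∀ l e n → e * c + suc (l * p) ≤ n → ∀ a → (+ p) ^ e ∣ˢ T l n a
  T-∣ l zero n h a = 1∣ (T l n a)
  T-∣ l (suc e) n h a with ℕₚ.m≤n⇒∃[o]m+o≡n p≤n
    where
    p≤n : p ≤ n
    p≤n = ℕₚ.≤-trans (ℕₚ.≤-trans (ℕₚ.≤-reflexive (ℕₚ.+-comm 1 c)) (ℕₚ.+-mono-≤ (ℕₚ.m≤m+n c (e * c)) (s≤s z≤n))) h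
  ... | n′ , refl = subst (λ n → (+ p) ^ suc e ∣ˢ T l n a) (ℕₚ.+-comm n′ p) (go l h)
    where
    e*c+l*p≤n′ : ∀ l → suc e * c + suc (l * p) ≤ p + n′ → e * c + suc (l * p) ≤ suc n′
    e*c+l*p≤n′ l h = ℕₚ.+-cancelˡ-≤ c _ _ (subst₂ _≤_ (ℕₚ.+-assoc c (e * c) _) (sym (ℕₚ.+-suc c n′)) h)
    go : ∀ l → suc e * c + suc (l * p) ≤ p + n′ → (+ p) ^ suc e ∣ˢ T l (n′ + p) a
    go zero    h = ∣-resp (sym (T-zero-+p n′ a)) (S.*-monoʳ-∣ (+ p) (⟦⟧-∣ H (T-∣ 0 e (suc n′) (e*c+l*p≤n′ 0 h)) a))
    go (suc l) h = ∣-resp (sym (T-suc-+p l n′ a))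
      (S.∣m∣n⇒∣m+n (S.∣m⇒∣-m (T-∣ l (suc e) n′ (ℕₚ.+-cancelˡ-≤ p _ _ (subst (_≤ p + n′) (move (suc e * c) (l * p) p) h)) a))
                   (S.*-monoʳ-∣ (+ p) (⟦⟧-∣ H (T-∣ (suc l) e (suc n′) (e*c+l*p≤n′ (suc l) h)) a)))
      where
      move : ∀ x y p → x + suc (p + y) ≡ p + (x + suc y)
      move = ℕ-solve-∀

  -- If f is constant modulo m, then δ kills it modulo m, and only the summand -1 of `H` = δQ - 1
  -- survives.
  H-lead : ∀ {m f} v → (∀ a → m ∣ˢ f a - v) → ∀ a → m ∣ˢ ⟦ H ⟧ f a +ℤ v
  H-lead {m} {f} v h a = ∣-resp (sym eq) (S.∣m∣n⇒∣m-n (⟦⟧-∣ Q δf a) (h a))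
    where
    telescope : ∀ x y v → (x - v) - (y - v) ≡ x - y
    telescope = solve-∀
    δf : ∀ a → m ∣ˢ ⟦ δ ⟧ f a
    δf a = ∣-resp (trans (telescope (f a) (f (a +ℤ 1ℤ)) v) (sym (⟦δ⟧ f a))) (S.∣m∣n⇒∣m-n (h a) (h (a +ℤ 1ℤ)))
    regroup : ∀ x y v → x +ℤ -1ℤ *ℤ y +ℤ v ≡ x - (y - v)
    regroup = solve-∀
    eq : ⟦ H ⟧ f a +ℤ v ≡ ⟦ Q ⟧ (⟦ δ ⟧ f) a - (f a - v)
    eq = trans (cong (λ z → z +ℤ -1ℤ *ℤ f a +ℤ v) (⟦⟧-comm δ Q f a)) (regroup (⟦ Q ⟧ (⟦ δ ⟧ f) a) (f a) v)

  -- Solution of w(l + 1, e + 1) = -w(l, e + 1) - p w(l + 1, e), the recurrence that `T-suc-+p`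
  -- imposes on leading terms. After removing signs and powers of p it is Pascal's rule.
  lead : ℕ → ℕ → ℤ
  lead l e = (-1ℤ ^ (e + l)) *ℤ + ((e + l) C l) *ℤ (+ p) ^ e

  lead-* : ∀ l e {x} → (+ p) ^ 2 ∣ˢ x → (+ p) ^ suc (suc e) ∣ˢ lead l e *ℤ x
  lead-* l e (divides q refl) = divides (w *ℤ q) (sym (regroup w q (+ p) ((+ p) ^ e)))
    where
    w = (-1ℤ ^ (e + l)) *ℤ + ((e + l) C l)
    regroup : ∀ w q p P → w *ℤ q *ℤ (p *ℤ (p *ℤ P)) ≡ w *ℤ P *ℤ (q *ℤ (p *ℤ (p *ℤ 1ℤ)))
    regroup = solve-∀

  -- This n is the last index at which `T-∣` guarantees only p^e; at n + 1 it gives p^(e+1). The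
  -- leading term is therefore independent of the base point a.
  T-lead : ∀ l e n → n ≡ l * p + suc e * c → ∀ a → (+ p) ^ suc e ∣ˢ T l n a - lead l e
  -- At a = 0 only k = 0 among 0, ..., p - 1 is a multiple of p, so the sum is 1. Moving a by one
  -- changes it by `T 0 p a`, a multiple of p.
  T-lead zero zero n refl rewrite ℕₚ.+-identityʳ c = ℤ-induction (λ a → (+ p) ^ 1 ∣ˢ T 0 c a - 1ℤ) start
    (λ a h → ∣-resp (telescope (T 0 c a) (T 0 c (a +ℤ 1ℤ))) (S.∣m∣n⇒∣m-n h (step a)))
    (λ a h → ∣-resp (telescope′ (T 0 c a) (T 0 c (a +ℤ 1ℤ))) (S.∣m∣n⇒∣m+n h (step a)))
    where
    telescope : ∀ x y → (x - 1ℤ) - (x - y) ≡ y - 1ℤ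
    telescope = solve-∀
    telescope′ : ∀ x y → (y - 1ℤ) +ℤ (x - y) ≡ x - 1ℤ
    telescope′ = solve-∀
    step : ∀ a → (+ p) ^ 1 ∣ˢ T 0 c a - T 0 c (a +ℤ 1ℤ)
    step a = ∣-resp (trans (sym (T-zero-+p 0 a)) (T-suc 0 c a)) (subst (_∣ˢ + p *ℤ ⟦ H ⟧ (T 0 1) a) (sym (ℤₚ.*-identityʳ (+ p))) (S.∣m⇒∣m*n _ S.∣-refl))
    start : (+ p) ^ 1 ∣ˢ T 0 c 0ℤ - 1ℤ
    start = ∣-resp (sym (cong (_- 1ℤ) (δ^-spread p c 0 (binom 0) 0ℤ (ℕₚ.n≤1+n c) (s≤s z≤n) (inj₂ ℕₚ.≤-refl)))) (divides 0ℤ refl)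
  T-lead zero (suc e) n n≡ a with ℕₚ.m≤n⇒∃[o]m+o≡n 0<c
  ... | c′ , refl = subst (λ n → (+ p) ^ suc (suc e) ∣ˢ T 0 n a - lead 0 (suc e)) (trans (index c′ e) (sym n≡))
      (∣-resp (sym eq) (S.*-monoʳ-∣ (+ p) (H-lead (lead 0 e) (T-lead 0 e (suc (c′ + e * c)) refl) a)))
    where
    index : ∀ c e → c + e * suc c + suc (suc c) ≡ suc (suc e) * suc c
    index = ℕ-solve-∀
    n′ = c′ + e * c
    factor : ∀ s b q p h → p *ℤ h - -1ℤ *ℤ s *ℤ b *ℤ (p *ℤ q) ≡ p *ℤ (h +ℤ s *ℤ b *ℤ q)
    factor = solve-∀
    eq : T 0 (n′ + p) a - lead 0 (suc e) ≡ + p *ℤ (⟦ H ⟧ (T 0 (suc n′)) a +ℤ lead 0 e)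
    eq = trans (cong (_- lead 0 (suc e)) (T-zero-+p n′ a))
      (factor (-1ℤ ^ (e + 0)) 1ℤ ((+ p) ^ e) (+ p) (⟦ H ⟧ (T 0 (suc n′)) a))
  T-lead (suc l) e n n≡ a = subst (λ n → (+ p) ^ suc e ∣ˢ T (suc l) n a - lead (suc l) e) (trans (index l p (suc e * c)) (sym n≡))
      (∣-resp (sym (cong (_- lead (suc l) e) (T-suc-+p l n′ a))) (go e))
    where
    n′ = l * p + suc e * c
    index : ∀ l p x → l * p + x + p ≡ suc l * p + x
    index = ℕ-solve-∀
    go : ∀ e → let n′ = l * p + suc e * c in
      (+ p) ^ suc e ∣ˢ - T l n′ a +ℤ + p *ℤ ⟦ H ⟧ (T (suc l) (suc n′)) a - lead (suc l) e
    go zero = ∣-resp (trans (rearrange (T l n″ a) (lead l 0) h) (cong (λ z → - T l n″ a +ℤ h - z) lead≡))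
        (S.∣m∣n⇒∣m+n (S.∣m⇒∣-m (T-lead l 0 n″ refl a))
          (subst (_∣ˢ h) (sym (ℤₚ.*-identityʳ (+ p))) (S.∣m⇒∣m*n _ S.∣-refl)))
      where
      n″ = l * p + 1 * c
      h = + p *ℤ ⟦ H ⟧ (T (suc l) (suc n″)) a
      rearrange : ∀ t v h → - (t - v) +ℤ h ≡ - t +ℤ h - (- v)
      rearrange = solve-∀
      negate : ∀ s x → - (s *ℤ x *ℤ 1ℤ) ≡ -1ℤ *ℤ s *ℤ x *ℤ 1ℤ
      negate = solve-∀
      lead≡ : - lead l 0 ≡ lead (suc l) 0
      lead≡ = trans (cong (λ b → - ((-1ℤ ^ l) *ℤ + b *ℤ 1ℤ)) (trans (nCn≡1 l) (sym (nCn≡1 (suc l))))) (negate (-1ℤ ^ l) (+ (suc l C suc l)))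
    go (suc e) = ∣-resp (trans (rearrange (T l n″ a) (lead l (suc e)) (+ p) h (lead (suc l) e)) (cong (λ z → - T l n″ a +ℤ + p *ℤ h - z) lead≡))
        (S.∣m∣n⇒∣m+n (S.∣m⇒∣-m (T-lead l (suc e) n″ refl a))
          (S.*-monoʳ-∣ (+ p) (H-lead (lead (suc l) e) (T-lead (suc l) e (suc n″) (index′ l c e)) a)))
      where
      n″ = l * p + suc (suc e) * c
      h = ⟦ H ⟧ (T (suc l) (suc n″)) a
      index′ : ∀ l c e → suc (l * suc c + suc (suc e) * c) ≡ suc l * suc c + suc e * c
      index′ = ℕ-solve-∀
      rearrange : ∀ t v p h w → - (t - v) +ℤ p *ℤ (h +ℤ w) ≡ - t +ℤ p *ℤ h - (- v - p *ℤ w)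
      rearrange = solve-∀
      collect : ∀ s x y p q → - (-1ℤ *ℤ s *ℤ x *ℤ (p *ℤ q)) - p *ℤ ((-1ℤ *ℤ s) *ℤ y *ℤ q) ≡ (-1ℤ *ℤ (-1ℤ *ℤ s)) *ℤ (x +ℤ y) *ℤ (p *ℤ q)
      collect = solve-∀
      lead≡ : - lead l (suc e) - + p *ℤ lead (suc l) e ≡ lead (suc l) (suc e)
      lead≡ rewrite ℕₚ.+-suc e l = trans
        (collect (-1ℤ ^ (e + l)) (+ (suc (e + l) C l)) (+ (suc (e + l) C suc l)) (+ p) ((+ p) ^ e))
        (cong (λ z → (-1ℤ ^ suc (suc (e + l))) *ℤ + z *ℤ ((+ p) ^ suc e)) (nCk+nC[k+1]≡[n+1]C[k+1] (suc (e + l)) l))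

-- First-order expansion modulo p²

⟦⟧-translate : ∀ P f u a → ⟦ P ⟧ (λ b → f (b +ℤ u)) a ≡ ⟦ P ⟧ f (a +ℤ u)
⟦⟧-translate E       f u a = cong f (swap a u)
  where
  swap : ∀ a u → a +ℤ 1ℤ +ℤ u ≡ a +ℤ u +ℤ 1ℤ
  swap = solve-∀
⟦⟧-translate (K c)   f u a = refl
⟦⟧-translate (P ⊕ Q) f u a = cong₂ _+ℤ_ (⟦⟧-translate P f u a) (⟦⟧-translate Q f u a)
⟦⟧-translate (P ⊗ Q) f u a = trans (⟦⟧-cong P (⟦⟧-translate Q f u) a) (⟦⟧-translate P (⟦ Q ⟧ f) u a)

-- The substitution k ↦ n - k in the alternating sum.
δ^-reflect : ∀ n f → (∀ a → f (- a) ≡ f a) → ∀ a → ⟦ δ ^ᵒ n ⟧ f a ≡ (-1ℤ ^ n) *ℤ ⟦ δ ^ᵒ n ⟧ f (- a - + n)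
δ^-reflect zero f even a = trans (cong (1ℤ *ℤ_) (trans (sym (even a)) (cong f (sym (ℤₚ.+-identityʳ (- a)))))) (sym (ℤₚ.*-identityˡ _))
δ^-reflect (suc n) f even a = begin
  ⟦ δ ^ᵒ suc n ⟧ f a                ≡⟨ ⟦δ⟧ g a ⟩
  g a - g (a +ℤ 1ℤ)                 ≡⟨ cong₂ _-_ (δ^-reflect n f even a) (δ^-reflect n f even (a +ℤ 1ℤ)) ⟩
  s *ℤ g (- a - + n) - s *ℤ g (- (a +ℤ 1ℤ) - + n)
    ≡⟨ cong₂ (λ u v → s *ℤ g u - s *ℤ g v) (move a (+ n)) (move′ a (+ n)) ⟩
  s *ℤ g (b +ℤ 1ℤ) - s *ℤ g b       ≡⟨ collect s (g b) (g (b +ℤ 1ℤ)) ⟩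
  -1ℤ *ℤ s *ℤ (g b - g (b +ℤ 1ℤ))   ≡⟨ cong (-1ℤ *ℤ s *ℤ_) (⟦δ⟧ g b) ⟨
  -1ℤ *ℤ s *ℤ ⟦ δ ^ᵒ suc n ⟧ f b    ∎
  where
  open ≡-Reasoning
  g = ⟦ δ ^ᵒ n ⟧ f
  s = -1ℤ ^ n
  b = - a - + suc n
  move : ∀ a n → - a - n ≡ - a - (1ℤ +ℤ n) +ℤ 1ℤ
  move = solve-∀
  move′ : ∀ a n → - (a +ℤ 1ℤ) - n ≡ - a - (1ℤ +ℤ n)
  move′ = solve-∀
  collect : ∀ s x y → s *ℤ y - s *ℤ x ≡ -1ℤ *ℤ s *ℤ (x - y)
  collect = solve-∀

module Expansion {c : ℕ} (p-prime : Prime (suc c)) (l : ℕ) where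
  open PrimePowers p-prime

  Φ : ℤ → ℤ
  Φ = spread p (spread p (binom l))

  Y G : Op
  Y = δ[ p ]
  G = δ ⊗ H

  -- Membership in a p-adic filtration for which p has weight p - 1 and Y has weight 1.
  Weight≥ : ℕ → Op → Set
  Weight≥ w P = ∀ i e → e * c + suc (l * p) ≤ i + w → ∀ a → (+ p) ^ e ∣ˢ ⟦ Y ^ᵒ i ⊗ P ⟧ Φ a

  δ^p≋ : δ ^ᵒ p ≋ Y ⊕ K (+ p) ⊗ G
  δ^p≋ = proj₂ (δ^p p-prime)

  ⟦Y^⟧Φ : ∀ i a → ⟦ Y ^ᵒ i ⟧ Φ a ≡ spread p (T l i) a
  ⟦Y^⟧Φ i a = δ[]^-spread p i (spread p (binom l)) a

  spread-∣ : ∀ {m f} → (∀ a → m ∣ˢ f a) → ∀ a → m ∣ˢ spread p f a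
  spread-∣ {m} {f} h a with residue-of p a
  ... | residue q zero    _   refl = ∣-resp (sym (trans (cong (spread p f) (ℤₚ.+-identityˡ (q *ℤ + p))) (spread-on p f q))) (h q)
  ... | residue q (suc r) r<p refl = ∣-resp (sym (spread-off p f q (suc r) (s≤s z≤n) r<p)) (divides 0ℤ refl)

  weight-≋ : ∀ {w P P′} → P ≋ P′ → Weight≥ w P → Weight≥ w P′
  weight-≋ {w} {P} {P′} e h i k le a = ∣-resp (at (Opᴿ.*-congˡ {Y ^ᵒ i} e) Φ a) (h i k le a)

  weight-≤ : ∀ {w w′ P} → w′ ≤ w → Weight≥ w P → Weight≥ w′ P
  weight-≤ w′≤w h i k le = h i k (ℕₚ.≤-trans le (ℕₚ.+-monoʳ-≤ i w′≤w))

  weight-⊕ : ∀ {w P P′} → Weight≥ w P → Weight≥ w P′ → Weight≥ w (P ⊕ P′)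
  weight-⊕ {w} {P} {P′} h h′ i k le a = ∣-resp (sym (⟦⟧-+ (Y ^ᵒ i) (⟦ P ⟧ Φ) (⟦ P′ ⟧ Φ) a)) (S.∣m∣n⇒∣m+n (h i k le a) (h′ i k le a))

  weight-⊗ : ∀ {w P} P′ → Weight≥ w P → Weight≥ w (P′ ⊗ P)
  weight-⊗ {w} {P} P′ h i k le a = ∣-resp (⟦⟧-comm P′ (Y ^ᵒ i) (⟦ P ⟧ Φ) a) (⟦⟧-∣ P′ (h i k le) a)

  -- Immediate because `Weight≥` tests divisibility after every further power of Y. Divisibility of
  -- `⟦ P ⟧ Φ` alone would say nothing about the gain from one more Y.
  weight-Y : ∀ {w P} → Weight≥ w P → Weight≥ (suc w) (Y ⊗ P)
  weight-Y {w} {P} h i k le a = ∣-resp (⟦⟧-comm Y (Y ^ᵒ i) (⟦ P ⟧ Φ) a) (h (suc i) k (subst (k * c + suc (l * p) ≤_) (ℕₚ.+-suc i w) le) a)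

  weight-p : ∀ {w P} → Weight≥ w P → Weight≥ (w + c) (K (+ p) ⊗ P)
  weight-p {w} {P} h i zero    le a = 1∣ _
  weight-p {w} {P} h i (suc k) le a = ∣-resp (sym (⟦⟧-* (Y ^ᵒ i) (+ p) (⟦ P ⟧ Φ) a)) (S.*-monoʳ-∣ (+ p) (h i k le′ a))
    where
    le′ : k * c + suc (l * p) ≤ i + w
    le′ = ℕₚ.+-cancelˡ-≤ c _ _ (subst₂ _≤_ (ℕₚ.+-assoc c (k * c) (suc (l * p))) (rotate i w c) le)
      where
      rotate : ∀ i w c → i + (w + c) ≡ c + (i + w)
      rotate = ℕ-solve-∀

  weight-K0 : ∀ {w} → Weight≥ w (K 0ℤ)
  weight-K0 i k le a = ∣-resp (sym (⟦⟧-0 (Y ^ᵒ i) a)) (divides 0ℤ refl)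

  -- The arithmetic of the sums for modulus p enters the filtration here, through `T-∣`; the other
  -- rules are formal.
  weight-Y^ : ∀ n → Weight≥ n (Y ^ᵒ n)
  weight-Y^ (suc n) = weight-Y {P = Y ^ᵒ n} (weight-Y^ n)
  weight-Y^ zero i k le a = ∣-resp (sym eq) (spread-∣ (T-∣ l k i (subst (k * c + suc (l * p) ≤_) (ℕₚ.+-identityʳ i) le)) a)
    where
    eq : ⟦ Y ^ᵒ i ⊗ K 1ℤ ⟧ Φ a ≡ spread p (T l i) a
    eq = trans (at (Opᴿ.*-identityʳ (Y ^ᵒ i)) Φ a) (⟦Y^⟧Φ i a)

  -- For p = 2 the weight of p²G² is only large enough because G is divisible by δ, so that G² is divisible by δ² = Y + 2G.
  weight-p²G² : ∀ {w P} → Weight≥ w P → Weight≥ (suc (suc w) + c) (K (+ p) ⊗ (K (+ p) ⊗ (G ⊗ (G ⊗ P))))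
  weight-p²G² {w} {P} h with 2 ℕ.≤? c
  ... | yes 2≤c = weight-≤ {P = K (+ p) ⊗ (K (+ p) ⊗ (G ⊗ (G ⊗ P)))} (ℕₚ.+-monoˡ-≤ c (subst (_≤ w + c) (ℕₚ.+-comm w 2) (ℕₚ.+-monoʳ-≤ w 2≤c)))
        (weight-p {P = K (+ p) ⊗ (G ⊗ (G ⊗ P))} (weight-p {P = G ⊗ (G ⊗ P)} (weight-⊗ {P = G ⊗ P} G (weight-⊗ {P = P} G h))))
  ... | no  2≰c = weight-≋ (Opᴿ.sym rewritten)
        (weight-⊗ {P = N} (H ⊗ H)
          (weight-≤ {P = N} (ℕₚ.≤-reflexive bound) (weight-⊕ {P = K (+ p) ⊗ (K (+ p) ⊗ (Y ⊗ P))} {P′ = K (+ p) ⊗ (K (+ p) ⊗ (K (+ p) ⊗ (G ⊗ P)))}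
            (weight-p {P = K (+ p) ⊗ (Y ⊗ P)} (weight-p {P = Y ⊗ P} (weight-Y {P = P} h)))
            (weight-≤ {P = K (+ p) ⊗ (K (+ p) ⊗ (K (+ p) ⊗ (G ⊗ P)))} (ℕₚ.+-monoˡ-≤ c (ℕₚ.+-monoˡ-≤ c (subst (_≤ w + c) (ℕₚ.+-comm w 1) (ℕₚ.+-monoʳ-≤ w 0<c))))
              (weight-p {P = K (+ p) ⊗ (K (+ p) ⊗ (G ⊗ P))} (weight-p {P = K (+ p) ⊗ (G ⊗ P)} (weight-p {P = G ⊗ P} (weight-⊗ {P = P} G h))))))))
    where
    N : Op
    N = K (+ p) ⊗ (K (+ p) ⊗ (Y ⊗ P)) ⊕ K (+ p) ⊗ (K (+ p) ⊗ (K (+ p) ⊗ (G ⊗ P)))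
    c≡1 : c ≡ 1
    c≡1 = ℕₚ.≤-antisym (ℕₚ.≤-pred (ℕₚ.≰⇒> 2≰c)) 0<c
    bound : suc (suc w) + c ≡ suc w + c + c
    bound = cong (_+ c) (trans (sym (ℕₚ.+-comm (suc w) 1)) (cong (λ c → suc w + c) (sym c≡1)))
    δ²≋ : δ ⊗ (δ ⊗ K 1ℤ) ≋ Y ⊕ K (+ p) ⊗ G
    δ²≋ = Opᴿ.trans (Opᴿ.reflexive (cong (λ c → δ ^ᵒ suc c) (sym c≡1))) δ^p≋
    rewritten : K (+ p) ⊗ (K (+ p) ⊗ (G ⊗ (G ⊗ P))) ≋ H ⊗ H ⊗ N
    rewritten = begin
      K (+ p) ⊗ (K (+ p) ⊗ (G ⊗ (G ⊗ P)))
        ≈⟨ solveᵒ 4 (λ k d h x → k :* (k :* ((d :* h) :* ((d :* h) :* x))) := h :* h :* (k :* (k :* (d :* (d :* con 1ℤ) :* x)))) Opᴿ.refl (K (+ p)) δ H P ⟩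
      H ⊗ H ⊗ (K (+ p) ⊗ (K (+ p) ⊗ (δ ⊗ (δ ⊗ K 1ℤ) ⊗ P)))
        ≈⟨ Opᴿ.*-congˡ {H ⊗ H} (Opᴿ.*-congˡ {K (+ p)} (Opᴿ.*-congˡ {K (+ p)} (Opᴿ.*-congʳ {P} δ²≋))) ⟩
      H ⊗ H ⊗ (K (+ p) ⊗ (K (+ p) ⊗ ((Y ⊕ K (+ p) ⊗ G) ⊗ P)))
        ≈⟨ solveᵒ 5 (λ k h y g x → h :* h :* (k :* (k :* ((y :+ k :* g) :* x))) := h :* h :* (k :* (k :* (y :* x)) :+ k :* (k :* (k :* (g :* x))))) Opᴿ.refl (K (+ p)) H Y G P ⟩
      H ⊗ H ⊗ N ∎
      where open ≋-Reasoning

  -- Multiplying by Y + pG creates three new error terms: p²G²Y^n from the linear term, Y R, and pG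
  -- R. Each again exceeds the weight of the main term by p - 1.
  first-order : ∀ n → ∃[ R ] (δ ^ᵒ p) ^ᵒ suc n ≋ Y ^ᵒ suc n ⊕ K (+ suc n) ⊗ (K (+ p) ⊗ (G ⊗ Y ^ᵒ n)) ⊕ R
                           × Weight≥ (suc n + c) R
  first-order zero = K 0ℤ , expand , weight-K0
    where
    open ≋-Reasoning
    expand : (δ ^ᵒ p) ^ᵒ 1 ≋ Y ^ᵒ 1 ⊕ K 1ℤ ⊗ (K (+ p) ⊗ (G ⊗ Y ^ᵒ 0)) ⊕ K 0ℤ
    expand = begin
      δ ^ᵒ p ⊗ K 1ℤ              ≈⟨ Opᴿ.*-congʳ {K 1ℤ} δ^p≋ ⟩
      (Y ⊕ K (+ p) ⊗ G) ⊗ K 1ℤ   ≈⟨ solveᵒ 3 (λ k y g → (y :+ k :* g) :* con 1ℤ := y :* con 1ℤ :+ con 1ℤ :* (k :* (g :* con 1ℤ)) :+ con 0ℤ) Opᴿ.refl (K (+ p)) Y G ⟩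
      Y ^ᵒ 1 ⊕ K 1ℤ ⊗ (K (+ p) ⊗ (G ⊗ Y ^ᵒ 0)) ⊕ K 0ℤ ∎
  first-order (suc n) with first-order n
  ... | R , e , wR = R′ , expand , weight-⊕ {P = K (+ suc n) ⊗ (K (+ p) ⊗ (K (+ p) ⊗ (G ⊗ (G ⊗ Y ^ᵒ n))))} {P′ = Y ⊗ R ⊕ G ⊗ (K (+ p) ⊗ R)}
      (weight-⊗ {P = K (+ p) ⊗ (K (+ p) ⊗ (G ⊗ (G ⊗ Y ^ᵒ n)))} (K (+ suc n)) (weight-p²G² {P = Y ^ᵒ n} (weight-Y^ n)))
      (weight-⊕ {P = Y ⊗ R} {P′ = G ⊗ (K (+ p) ⊗ R)} (weight-Y {P = R} wR)
        (weight-⊗ {P = K (+ p) ⊗ R} G (weight-≤ {P = K (+ p) ⊗ R} bound (weight-p {P = R} wR))))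
    where
    open ≋-Reasoning
    R′ = K (+ suc n) ⊗ (K (+ p) ⊗ (K (+ p) ⊗ (G ⊗ (G ⊗ Y ^ᵒ n)))) ⊕ (Y ⊗ R ⊕ G ⊗ (K (+ p) ⊗ R))
    bound : suc (suc n) + c ≤ suc n + c + c
    bound = subst (_≤ suc n + c + c) (ℕₚ.+-comm (suc n + c) 1) (ℕₚ.+-monoʳ-≤ (suc n + c) 0<c)
    K-suc : K (+ suc (suc n)) ≋ K 1ℤ ⊕ K (+ suc n)
    K-suc = mk≋ λ f a → ℤₚ.*-distribʳ-+ (f a) 1ℤ (+ suc n)
    expand : (δ ^ᵒ p) ^ᵒ suc (suc n) ≋ Y ^ᵒ suc (suc n) ⊕ K (+ suc (suc n)) ⊗ (K (+ p) ⊗ (G ⊗ Y ^ᵒ suc n)) ⊕ R′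
    expand = begin
      δ ^ᵒ p ⊗ (δ ^ᵒ p) ^ᵒ suc n
        ≈⟨ Opᴿ.*-cong δ^p≋ e ⟩
      (Y ⊕ K (+ p) ⊗ G) ⊗ (Y ⊗ Y ^ᵒ n ⊕ K (+ suc n) ⊗ (K (+ p) ⊗ (G ⊗ Y ^ᵒ n)) ⊕ R)
        ≈⟨ solveᵒ 6 (λ k y g m x r → (y :+ k :* g) :* (y :* x :+ m :* (k :* (g :* x)) :+ r) :=
              y :* (y :* x) :+ (con 1ℤ :+ m) :* (k :* (g :* (y :* x))) :+ (m :* (k :* (k :* (g :* (g :* x)))) :+ (y :* r :+ g :* (k :* r))))
             Opᴿ.refl (K (+ p)) Y G (K (+ suc n)) (Y ^ᵒ n) R ⟩
      Y ⊗ (Y ⊗ Y ^ᵒ n) ⊕ (K 1ℤ ⊕ K (+ suc n)) ⊗ (K (+ p) ⊗ (G ⊗ (Y ⊗ Y ^ᵒ n))) ⊕ R′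
        ≈⟨ Opᴿ.+-congʳ {R′} (Opᴿ.+-congˡ {Y ⊗ (Y ⊗ Y ^ᵒ n)} (Opᴿ.*-congʳ {K (+ p) ⊗ (G ⊗ (Y ⊗ Y ^ᵒ n))} (Opᴿ.sym K-suc))) ⟩
      Y ^ᵒ suc (suc n) ⊕ K (+ suc (suc n)) ⊗ (K (+ p) ⊗ (G ⊗ Y ^ᵒ suc n)) ⊕ R′ ∎

  -- The coefficient n of the linear term is left out, so that a factor p of n can be used
  -- separately.
  correction : ℕ → ℕ → ℤ → ℤ
  correction s n a = + p *ℤ ⟦ δ ^ᵒ s ⊗ G ⟧ (⟦ Y ^ᵒ n ⟧ Φ) a

  main-expansion : ∀ e n → e * c + suc (l * p) ≤ suc n → ∀ s a →
    (+ p) ^ suc e ∣ˢ ⟦ δ ^ᵒ (p * suc n + s) ⟧ Φ a - (⟦ δ ^ᵒ s ⟧ (spread p (T l (suc n))) a +ℤ + suc n *ℤ correction s n a)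
  main-expansion e n le s a with first-order n
  ... | R , eq , wR = ∣-resp (sym (trans (cong (_- main) expanded) (cancel main (⟦ δ ^ᵒ s ⟧ (⟦ R ⟧ Φ) a))))
      (⟦⟧-∣ (δ ^ᵒ s) (λ a → ∣-resp (ℤₚ.*-identityˡ _) (wR 0 (suc e) le′ a)) a)
    where
    main = ⟦ δ ^ᵒ s ⟧ (spread p (T l (suc n))) a +ℤ + suc n *ℤ correction s n a
    cancel : ∀ x y → x +ℤ y - x ≡ y
    cancel = solve-∀
    le′ : suc e * c + suc (l * p) ≤ suc n + c
    le′ = subst₂ _≤_ (sym (ℕₚ.+-assoc c (e * c) (suc (l * p)))) (ℕₚ.+-comm c (suc n)) (ℕₚ.+-monoʳ-≤ c le)
    opExpanded : δ ^ᵒ (p * suc n + s) ≋ δ ^ᵒ s ⊗ Y ^ᵒ suc n ⊕ K (+ suc n) ⊗ (K (+ p) ⊗ (δ ^ᵒ s ⊗ G ⊗ Y ^ᵒ n)) ⊕ δ ^ᵒ s ⊗ R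
    opExpanded = begin
      δ ^ᵒ (p * suc n + s)                  ≈⟨ ^-homo-* δ (p * suc n) s ⟩
      δ ^ᵒ (p * suc n) ⊗ δ ^ᵒ s             ≈⟨ Opᴿ.*-congʳ {δ ^ᵒ s} (Opᴿ.trans (Opᴿ.sym (^-assocʳ δ p (suc n))) eq) ⟩
      (Y ^ᵒ suc n ⊕ K (+ suc n) ⊗ (K (+ p) ⊗ (G ⊗ Y ^ᵒ n)) ⊕ R) ⊗ δ ^ᵒ s
        ≈⟨ solveᵒ 7 (λ y m k g x r d → (y :+ m :* (k :* (g :* x)) :+ r) :* d := d :* y :+ m :* (k :* (d :* g :* x)) :+ d :* r) Opᴿ.refl
             (Y ^ᵒ suc n) (K (+ suc n)) (K (+ p)) G (Y ^ᵒ n) R (δ ^ᵒ s) ⟩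
      δ ^ᵒ s ⊗ Y ^ᵒ suc n ⊕ K (+ suc n) ⊗ (K (+ p) ⊗ (δ ^ᵒ s ⊗ G ⊗ Y ^ᵒ n)) ⊕ δ ^ᵒ s ⊗ R ∎
      where open ≋-Reasoning
    expanded : ⟦ δ ^ᵒ (p * suc n + s) ⟧ Φ a ≡ main +ℤ ⟦ δ ^ᵒ s ⟧ (⟦ R ⟧ Φ) a
    expanded = trans (at opExpanded Φ a)
      (cong (λ z → z +ℤ + suc n *ℤ correction s n a +ℤ ⟦ δ ^ᵒ s ⟧ (⟦ R ⟧ Φ) a) (⟦⟧-cong (δ ^ᵒ s) (⟦Y^⟧Φ (suc n)) a))

  correction-∣ : ∀ e s n → e * c + suc (l * p) ≤ n → ∀ a → (+ p) ^ suc e ∣ˢ correction s n a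
  correction-∣ e s n le a = S.*-monoʳ-∣ (+ p) (⟦⟧-∣ (δ ^ᵒ s ⊗ G)
    (λ a → ∣-resp (sym (⟦Y^⟧Φ n a)) (spread-∣ (T-∣ l e n le) a)) a)

  correction-p∣ : ∀ s n a → (+ p) ^ 1 ∣ˢ correction s n a
  correction-p∣ s n a = subst (_∣ˢ correction s n a) (sym (ℤₚ.*-identityʳ (+ p))) (S.∣m⇒∣m*n _ S.∣-refl)

  -- Having one Y fewer than the main term may cost one power of p; the explicit factor p restores
  -- it.
  correction-∣′ : ∀ e s n → e * c + suc (l * p) ≤ suc n → ∀ a → (+ p) ^ e ∣ˢ correction s n a
  correction-∣′ zero    s n le a = 1∣ _
  correction-∣′ (suc e) s n le a = correction-∣ e s n
    (ℕₚ.≤-pred (ℕₚ.≤-trans (ℕₚ.≤-trans (ℕₚ.+-monoˡ-≤ (e * c + suc (l * p)) 0<c) (ℕₚ.≤-reflexive (sym (ℕₚ.+-assoc c (e * c) _)))) le)) a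

  δ^p-on-Y-kernel : ∀ f → (∀ a → ⟦ Y ⟧ f a ≡ 0ℤ) → ∀ a → ⟦ δ ^ᵒ p ⟧ f a ≡ + p *ℤ ⟦ G ⟧ f a
  δ^p-on-Y-kernel f h a = trans (at δ^p≋ f a) (trans (cong (_+ℤ + p *ℤ ⟦ G ⟧ f a) (h a)) (ℤₚ.+-identityˡ _))

  -- By `T-lead`, Y^n Φ is, to leading order, a constant times the indicator of the multiples of p.
  -- That indicator is p-periodic, so Y kills it and pG acts on it as δ^p; hence the sum of length s
  -- + p with l = 0.
  correction-lead : ∀ e s n → n ≡ l * p + suc e * c → ∀ a →
    (+ p) ^ suc (suc e) ∣ˢ correction s n a - lead l e *ℤ T 0 (s + p) a
  correction-lead e s n n≡ a = ∣-resp eq (S.*-monoʳ-∣ (+ p) (⟦⟧-∣ (δ ^ᵒ s ⊗ G) difference a))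
    where
    S₀ = spread p (binom 0)
    difference : ∀ a → (+ p) ^ suc e ∣ˢ ⟦ Y ^ᵒ n ⟧ Φ a +ℤ - lead l e *ℤ S₀ a
    difference a = ∣-resp (cong (_+ℤ - lead l e *ℤ S₀ a) (sym (⟦Y^⟧Φ n a))) (by-residue a)
      where
      to-minus : ∀ x v → x - v ≡ x +ℤ - v *ℤ 1ℤ
      to-minus = solve-∀
      by-residue : ∀ a → (+ p) ^ suc e ∣ˢ spread p (T l n) a +ℤ - lead l e *ℤ S₀ a
      by-residue a = ∣-resp (sym (≗-by-residue p {λ a → spread p (T l n) a +ℤ - lead l e *ℤ S₀ a} {spread p (λ q → T l n q - lead l e)}
        (λ q → trans (cong₂ (λ u v → u +ℤ - lead l e *ℤ v) (spread-on p (T l n) q) (spread-on p (binom 0) q))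
                     (trans (sym (to-minus (T l n q) (lead l e))) (sym (spread-on p (λ q → T l n q - lead l e) q))))
        (λ q r 0<r r<p → trans (cong₂ (λ u v → u +ℤ - lead l e *ℤ v) (spread-off p (T l n) q r 0<r r<p) (spread-off p (binom 0) q r 0<r r<p))
                     (trans (cong (0ℤ +ℤ_) (ℤₚ.*-zeroʳ (- lead l e))) (sym (spread-off p (λ q → T l n q - lead l e) q r 0<r r<p)))) a))
        (spread-∣ (T-lead l e n n≡) a)
    O = δ ^ᵒ s ⊗ G
    T≡ : + p *ℤ ⟦ O ⟧ S₀ a ≡ T 0 (s + p) a
    T≡ = trans (sym (⟦⟧-* (δ ^ᵒ s) (+ p) (⟦ G ⟧ S₀) a))
      (trans (⟦⟧-cong (δ ^ᵒ s) (λ a → sym (δ^p-on-Y-kernel S₀ δ[p]-spread-binom-zero a)) a)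
             (sym (at (^-homo-* δ s p) S₀ a)))
    rearrange : ∀ p x v y → p *ℤ (x +ℤ - v *ℤ y) ≡ p *ℤ x - v *ℤ (p *ℤ y)
    rearrange = solve-∀
    eq : + p *ℤ ⟦ O ⟧ (λ a → ⟦ Y ^ᵒ n ⟧ Φ a +ℤ - lead l e *ℤ S₀ a) a ≡ correction s n a - lead l e *ℤ T 0 (s + p) a
    eq = trans (cong (+ p *ℤ_) (trans (⟦⟧-+ O (⟦ Y ^ᵒ n ⟧ Φ) (λ a → - lead l e *ℤ S₀ a) a)
                                      (cong (⟦ O ⟧ (⟦ Y ^ᵒ n ⟧ Φ) a +ℤ_) (⟦⟧-* O (- lead l e) S₀ a))))
      (trans (rearrange (+ p) (⟦ O ⟧ (⟦ Y ^ᵒ n ⟧ Φ) a) (lead l e) (⟦ O ⟧ S₀ a))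
             (cong (λ z → correction s n a - lead l e *ℤ z) T≡))

-- Sums of binomial coefficients over residue classes

prime∤! : ∀ {p} → Prime p → ∀ k → k < p → ¬ p ∣ k !
prime∤! {suc (suc p)} p-prime zero k<p p∣1 = contradiction (∣ₚ.∣⇒≤ p∣1) (ℕₚ.<⇒≱ (s≤s (s≤s z≤n)))
prime∤! p-prime (suc k) k<p p∣ with euclidsLemma (suc k) (k !) p-prime p∣
... | inj₁ p∣k  = <⇒∤ (s≤s z≤n) k<p p∣k
... | inj₂ p∣k! = prime∤! p-prime k (ℕₚ.<-trans (ℕₚ.n<1+n k) k<p) p∣k!

prime-^-cancel : ∀ {p} → Prime p → ∀ {k} → ¬ p ∣ k → ∀ j x → (+ p) ^ j ∣ˢ + k *ℤ x → (+ p) ^ j ∣ˢ x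
prime-^-cancel p-prime p∤k zero x _ = divides x (sym (ℤₚ.*-identityʳ x))
prime-^-cancel {p@(suc _)} p-prime {k} p∤k (suc j) x h
  with euclidsLemma k ℤ.∣ x ∣ p-prime (subst (p ∣_) (ℤₚ.abs-* (+ k) x) (S.∣⇒∣ᵤ {+ p} {+ k *ℤ x} (S.∣-trans (S.∣m⇒∣m*n {+ p} ((+ p) ^ j) S.∣-refl) h)))
... | inj₁ p∣k = contradiction p∣k p∤k
... | inj₂ p∣x with S.∣ᵤ⇒∣ {+ p} {x} p∣x
...   | divides q refl = subst ((+ p) ^ suc j ∣ˢ_) (ℤₚ.*-comm (+ p) q)
        (S.*-monoʳ-∣ (+ p) (prime-^-cancel p-prime p∤k j q (S.*-cancelˡ-∣ (+ p) (∣-resp (swap (+ k) q (+ p)) h))))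
  where
  swap : ∀ k q p → k *ℤ (q *ℤ p) ≡ p *ℤ (k *ℤ q)
  swap = solve-∀

C-! : ∀ s d → ((s + d) C s) * (s ! * d !) ≡ (s + d) !
C-! zero    d = trans (ℕₚ.*-identityˡ (1 * d !)) (ℕₚ.*-identityˡ (d !))
C-! (suc s) d = begin
  (suc (s + d) C suc s) * (suc s * s ! * d !)     ≡⟨ regroup (suc (s + d) C suc s) (suc s) (s !) (d !) ⟩
  suc s * (suc (s + d) C suc s) * (s ! * d !)   ≡⟨ cong (_* (s ! * d !)) (absorption (s + d) s) ⟩
  suc (s + d) * ((s + d) C s) * (s ! * d !)     ≡⟨ ℕₚ.*-assoc (suc (s + d)) ((s + d) C s) (s ! * d !) ⟩
  suc (s + d) * (((s + d) C s) * (s ! * d !))   ≡⟨ cong (suc (s + d) *_) (C-! s d) ⟩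
  suc (s + d) ! ∎
  where
  open ≡-Reasoning
  regroup : ∀ x a b d → x * (a * b * d) ≡ a * x * (b * d)
  regroup = ℕ-solve-∀

-1^[2*t] : ∀ t → -1ℤ ^ (2 * t) ≡ 1ℤ
-1^[2*t] t = trans (sym (ℤₚ.^-*-assoc -1ℤ 2 t)) (ℤₚ.^-zeroˡ t)

i≡-i⇒i≡0 : ∀ i → i ≡ - i → i ≡ 0ℤ
i≡-i⇒i≡0 (+ zero) _ = refl

module ResidueSums {c : ℕ} (p-prime : Prime (suc c)) where
  open PrimePowers p-prime

  S₀ : ℤ → ℤ
  S₀ = spread p (binom 0)

  S₀-periodic : ∀ u a → S₀ (a +ℤ u *ℤ + p) ≡ S₀ a
  S₀-periodic u = ≗-by-residue p {λ a → S₀ (a +ℤ u *ℤ + p)}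
    (λ q → trans (cong S₀ (add q u (+ p))) (trans (spread-on p (binom 0) (q +ℤ u)) (sym (spread-on p (binom 0) q))))
    (λ q r 0<r r<p → trans (cong S₀ (add′ (+ r) q u (+ p))) (trans (spread-off p (binom 0) (q +ℤ u) r 0<r r<p) (sym (spread-off p (binom 0) q r 0<r r<p))))
    where
    add : ∀ q u p → q *ℤ p +ℤ u *ℤ p ≡ (q +ℤ u) *ℤ p
    add = solve-∀
    add′ : ∀ r q u p → r +ℤ q *ℤ p +ℤ u *ℤ p ≡ r +ℤ (q +ℤ u) *ℤ p
    add′ = solve-∀

  S₀-even : ∀ a → S₀ (- a) ≡ S₀ a
  S₀-even = ≗-by-residue p {λ a → S₀ (- a)}
    (λ q → trans (cong S₀ (ℤₚ.neg-distribˡ-* q (+ p))) (trans (spread-on p (binom 0) (- q)) (sym (spread-on p (binom 0) q))))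
    (λ q r 0<r r<p → trans (cong S₀ (complement q r r<p))
      (trans (spread-off p (binom 0) (- q - 1ℤ) (p ∸ r) (ℕₚ.m<n⇒0<n∸m r<p) (ℕₚ.∸-monoʳ-< 0<r (ℕₚ.<⇒≤ r<p)))
             (sym (spread-off p (binom 0) q r 0<r r<p))))
    where
    negate : ∀ r q d → - (r +ℤ q *ℤ (r +ℤ d)) ≡ d +ℤ (- q - 1ℤ) *ℤ (r +ℤ d)
    negate = solve-∀
    complement : ∀ q r → r < p → - (+ r +ℤ q *ℤ + p) ≡ + (p ∸ r) +ℤ (- q - 1ℤ) *ℤ + p
    complement q r r<p = subst (λ p′ → - (+ r +ℤ q *ℤ + p′) ≡ + (p ∸ r) +ℤ (- q - 1ℤ) *ℤ + p′)
      (ℕₚ.m+[n∸m]≡n (ℕₚ.<⇒≤ r<p)) (negate (+ r) q (+ (p ∸ r)))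

  -- The map k ↦ p + 2t - k preserves the class of t modulo p and the binomial coefficients, but it
  -- reverses the sign since p + 2t is odd. So the sum equals its own negative.
  T₀-symmetric : p ≢ 2 → ∀ t u → T 0 (2 * t + p) (u *ℤ + p - + t) ≡ 0ℤ
  T₀-symmetric p≢2 t u = i≡-i⇒i≡0 _ (begin
    T 0 n a                               ≡⟨ δ^-reflect n S₀ S₀-even a ⟩
    (-1ℤ ^ n) *ℤ T 0 n (- a - + n)        ≡⟨ cong₂ _*ℤ_ sign (cong (T 0 n) reflected) ⟩
    -1ℤ *ℤ T 0 n (a +ℤ v)                 ≡⟨ cong (-1ℤ *ℤ_) (⟦⟧-translate (δ ^ᵒ n) S₀ v a) ⟨
    -1ℤ *ℤ ⟦ δ ^ᵒ n ⟧ (λ b → S₀ (b +ℤ v)) a ≡⟨ cong (-1ℤ *ℤ_) (⟦⟧-cong (δ ^ᵒ n) (S₀-periodic (- u - u - 1ℤ)) a) ⟩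
    -1ℤ *ℤ T 0 n a                        ≡⟨ ℤₚ.-1*i≡-i (T 0 n a) ⟩
    - T 0 n a                             ∎)
    where
    open ≡-Reasoning
    n = 2 * t + p
    a = u *ℤ + p - + t
    -- From -a - n = -(up - t) - (2t + p) = a - (2u + 1)p, a shift by a multiple of the period.
    v = (- u - u - 1ℤ) *ℤ + p
    sign : -1ℤ ^ n ≡ -1ℤ
    sign = trans (ℤₚ.^-distribˡ-+-* -1ℤ (2 * t) p) (cong₂ _*ℤ_ (-1^[2*t] t) (odd-prime-sign p-prime p≢2))
    rearrange : ∀ u p t → - (u *ℤ p - t) - (t +ℤ (t +ℤ 0ℤ) +ℤ p) ≡ u *ℤ p - t +ℤ (- u - u - 1ℤ) *ℤ p
    rearrange = solve-∀
    reflected : - a - + n ≡ a +ℤ v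
    reflected = rearrange u (+ p) (+ t)

  -- With t = s + d + 1, the quotient s! d! / t! equals 1 / (t C(t-1, s)), an entry of Leibniz's
  -- harmonic triangle. The rule of that triangle matches the difference in s of the sums; clearing
  -- denominators by t! keeps everything integral.
  T₀-! : ∀ s d → suc (s + d) < p → ∀ u →
    (+ p) ^ 2 ∣ˢ + (suc (s + d) !) *ℤ T 0 (s + p) (u *ℤ + p - + suc (s + d)) - (-1ℤ ^ suc s) *ℤ + (s !) *ℤ + (d !) *ℤ + p
  -- For s = 0 a single term (-1)^t C(p, t) remains. Absorption gives t C(p, t) = p C(p-1, t-1), and
  -- (-1)^(t-1) C(p-1, t-1) ≡ 1 modulo p is the base case of `T-lead`, read off at another point.
  T₀-! zero d t<p u = ∣-resp (sym eq) (S.∣n⇒∣m*n (- + (d !)) (S.*-monoʳ-∣ (+ p) (∣-resp (cong (_- 1ℤ) edge) (T-lead 0 0 c (sym (ℕₚ.*-identityˡ c)) (u *ℤ + p - + d)))))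
    where
    σ = -1ℤ ^ d
    edge : T 0 c (u *ℤ + p - + d) ≡ σ *ℤ + (c C d) *ℤ 1ℤ
    edge = δ^-spread p c d (binom 0) u (ℕₚ.n≤1+n c) (ℕₚ.<-trans (ℕₚ.n<1+n d) t<p) (inj₂ ℕₚ.≤-refl)
    absorb : + suc d *ℤ + (p C suc d) ≡ + p *ℤ + (c C d)
    absorb = trans (sym (ℤₚ.pos-* (suc d) (p C suc d))) (trans (cong +_ (absorption c d)) (ℤₚ.pos-* p (c C d)))
    pull : ∀ t d σ C → t *ℤ d *ℤ (-1ℤ *ℤ σ *ℤ C *ℤ 1ℤ) ≡ - (d *ℤ σ *ℤ (t *ℤ C))
    pull = solve-∀
    finish : ∀ d σ p C → - (d *ℤ σ *ℤ (p *ℤ C)) - -1ℤ *ℤ 1ℤ *ℤ d *ℤ p ≡ - d *ℤ (p *ℤ (σ *ℤ C *ℤ 1ℤ - 1ℤ))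
    finish = solve-∀
    eq : + (suc d !) *ℤ T 0 p (u *ℤ + p - + suc d) - -1ℤ *ℤ 1ℤ *ℤ + (d !) *ℤ + p ≡ - + (d !) *ℤ (+ p *ℤ (σ *ℤ + (c C d) *ℤ 1ℤ - 1ℤ))
    eq = trans (cong (_- -1ℤ *ℤ 1ℤ *ℤ + (d !) *ℤ + p)
                 (trans (cong₂ _*ℤ_ (ℤₚ.pos-* (suc d) (d !)) (δ^-spread p p (suc d) (binom 0) u ℕₚ.≤-refl t<p (inj₁ (s≤s z≤n))))
                   (trans (pull (+ suc d) (+ (d !)) σ (+ (p C suc d))) (cong (λ z → - (+ (d !) *ℤ σ *ℤ z)) absorb))))
           (finish (+ (d !)) σ (+ p) (+ (c C d)))
  T₀-! (suc s) d t<p u = ∣-resp (sym eq) (S.∣m∣n⇒∣m-n ih₁ (S.∣n⇒∣m*n (+ suc (suc (s + d))) (T₀-! s d (ℕₚ.<-trans (ℕₚ.n<1+n _) t<p) u)))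
    where
    t′ = suc (s + d)
    a = u *ℤ + p - + suc t′
    x = T 0 (s + p) a
    y = T 0 (s + p) (u *ℤ + p - + t′)
    σ = -1ℤ ^ suc s
    ih₁ : (+ p) ^ 2 ∣ˢ + (suc t′ !) *ℤ x - σ *ℤ + (s !) *ℤ + (suc d !) *ℤ + p
    ih₁ = subst (λ k → (+ p) ^ 2 ∣ˢ + (suc k !) *ℤ T 0 (s + p) (u *ℤ + p - + suc k) - σ *ℤ + (s !) *ℤ + (suc d !) *ℤ + p)
      (ℕₚ.+-suc s d) (T₀-! s (suc d) (subst (λ k → suc k < p) (sym (ℕₚ.+-suc s d)) t<p) u)
    shift : ∀ x t → x - (1ℤ +ℤ t) +ℤ 1ℤ ≡ x - t
    shift = solve-∀
    split : T 0 (suc s + p) a ≡ x - y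
    split = trans (T-suc 0 (s + p) a) (cong (λ b → x - T 0 (s + p) b) (shift (u *ℤ + p) (+ t′)))
    combine : ∀ s d t x y σ s! d! p →
      (1ℤ +ℤ (1ℤ +ℤ (s +ℤ d))) *ℤ t *ℤ (x - y) - -1ℤ *ℤ σ *ℤ ((1ℤ +ℤ s) *ℤ s!) *ℤ d! *ℤ p
        ≡ ((1ℤ +ℤ (1ℤ +ℤ (s +ℤ d))) *ℤ t *ℤ x - σ *ℤ s! *ℤ ((1ℤ +ℤ d) *ℤ d!) *ℤ p)
          - (1ℤ +ℤ (1ℤ +ℤ (s +ℤ d))) *ℤ (t *ℤ y - σ *ℤ s! *ℤ d! *ℤ p)
    combine = solve-∀
    glue : ∀ s d t x y σ s! d! p {t!′ s!′ d!′ z} →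
      t!′ ≡ (1ℤ +ℤ (1ℤ +ℤ (s +ℤ d))) *ℤ t → s!′ ≡ (1ℤ +ℤ s) *ℤ s! → d!′ ≡ (1ℤ +ℤ d) *ℤ d! → z ≡ x - y →
      t!′ *ℤ z - -1ℤ *ℤ σ *ℤ s!′ *ℤ d! *ℤ p
        ≡ (t!′ *ℤ x - σ *ℤ s! *ℤ d!′ *ℤ p) - (1ℤ +ℤ (1ℤ +ℤ (s +ℤ d))) *ℤ (t *ℤ y - σ *ℤ s! *ℤ d! *ℤ p)
    glue s d t x y σ s! d! p refl refl refl refl = combine s d t x y σ s! d! p
    eq : + (suc t′ !) *ℤ T 0 (suc s + p) a - -1ℤ *ℤ σ *ℤ + (suc s !) *ℤ + (d !) *ℤ + p
       ≡ (+ (suc t′ !) *ℤ x - σ *ℤ + (s !) *ℤ + (suc d !) *ℤ + p) - + suc t′ *ℤ (+ (t′ !) *ℤ y - σ *ℤ + (s !) *ℤ + (d !) *ℤ + p)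
    eq = glue (+ s) (+ d) (+ (t′ !)) x y σ (+ (s !)) (+ (d !)) (+ p)
      (ℤₚ.pos-* (suc t′) (t′ !)) (ℤₚ.pos-* (suc s) (s !)) (ℤₚ.pos-* (suc d) (d !)) split

  T₀-below : ∀ s t → s < t → t < p → ∀ u →
    (+ p) ^ 2 ∣ˢ + t *ℤ + ((t ∸ 1) C s) *ℤ T 0 (s + p) (u *ℤ + p - + t) - (-1ℤ ^ suc s) *ℤ + p
  T₀-below s t s<t t<p u with ℕₚ.m≤n⇒∃[o]m+o≡n s<t
  ... | d , refl = prime-^-cancel p-prime p∤s!d! 2 _ (∣-resp eq (T₀-! s d t<p u))
    where
    x = T 0 (s + p) (u *ℤ + p - + suc (s + d))
    σ = -1ℤ ^ suc s
    b = (s + d) C s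
    p∤s!d! : ¬ suc c ∣ s ! * d !
    p∤s!d! p∣ with euclidsLemma (s !) (d !) p-prime p∣
    ... | inj₁ p∣s! = prime∤! p-prime s (ℕₚ.≤-<-trans (ℕₚ.m≤m+n s d) (ℕₚ.<-trans (ℕₚ.n<1+n _) t<p)) p∣s!
    ... | inj₂ p∣d! = prime∤! p-prime d (ℕₚ.≤-<-trans (ℕₚ.m≤n+m d s) (ℕₚ.<-trans (ℕₚ.n<1+n _) t<p)) p∣d!
    factor : ∀ t b s d x σ p → t *ℤ (b *ℤ (s *ℤ d)) *ℤ x - σ *ℤ s *ℤ d *ℤ p ≡ s *ℤ d *ℤ (t *ℤ b *ℤ x - σ *ℤ p)
    factor = solve-∀
    t!≡ : + (suc (s + d) !) ≡ + suc (s + d) *ℤ (+ b *ℤ (+ (s !) *ℤ + (d !)))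
    t!≡ = trans (ℤₚ.pos-* (suc (s + d)) ((s + d) !)) (cong (+ suc (s + d) *ℤ_)
      (trans (cong +_ (sym (C-! s d))) (trans (ℤₚ.pos-* b (s ! * d !)) (cong (+ b *ℤ_) (ℤₚ.pos-* (s !) (d !))))))
    eq : + (suc (s + d) !) *ℤ x - σ *ℤ + (s !) *ℤ + (d !) *ℤ + p ≡ + (s ! * d !) *ℤ (+ suc (s + d) *ℤ + b *ℤ x - σ *ℤ + p)
    eq = trans (cong (λ z → z *ℤ x - σ *ℤ + (s !) *ℤ + (d !) *ℤ + p) t!≡)
      (trans (factor (+ suc (s + d)) (+ b) (+ (s !)) (+ (d !)) x σ (+ p))
             (cong (_*ℤ (+ suc (s + d) *ℤ + b *ℤ x - σ *ℤ + p)) (sym (ℤₚ.pos-* (s !) (d !)))))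

-- Exponents and normalisation

applyUpTo-+ : ∀ {A : Set} (f : ℕ → A) m n → applyUpTo f (m + n) ≡ applyUpTo f m ++ applyUpTo (λ k → f (m + k)) n
applyUpTo-+ f zero    n = refl
applyUpTo-+ f (suc m) n = cong (f 0 ∷_) (applyUpTo-+ (λ k → f (suc k)) m n)

∤⇒coprime : ∀ {p} → Prime p → ∀ {k} → ¬ p ∣ k → Coprime k p
∤⇒coprime p-prime p∤k (d∣k , d∣p) with prime⇒irreducible p-prime d∣p
... | inj₁ d≡1  = d≡1
... | inj₂ refl = contradiction d∣k p∤k

∤⇒coprime-^ : ∀ {p} → Prime p → ∀ {k} → ¬ p ∣ k → ∀ b → Coprime k (p ℕ.^ b)
∤⇒coprime-^ p-prime p∤k zero    (_ , d∣1) = ∣ₚ.∣1⇒≡1 d∣1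
∤⇒coprime-^ p-prime p∤k (suc b) (d∣k , d∣p^) = ∤⇒coprime-^ p-prime p∤k b
  (d∣k , coprime-divisor (λ (i∣d , i∣p) → ∤⇒coprime p-prime p∤k (∣ₚ.∣-trans i∣d d∣k , i∣p)) d∣p^)

-- Cut 1, ..., p^(b+1) into p^b blocks of p consecutive numbers. In each block only the last number
-- is divisible by p, and the others are prime to p^(b+1).
totient-^ : ∀ {c} → Prime (suc c) → ∀ b → totient (suc c ℕ.^ suc b) ≡ suc c ℕ.^ b * c
totient-^ {c} p-prime b = begin
  totient m                                  ≡⟨ cong (λ ks → length (filter P? ks)) (Listₚ.map-upTo suc m) ⟩
  count suc m                                ≡⟨ cong (count suc) (ℕₚ.*-comm p (p ℕ.^ b)) ⟩
  count suc (p ℕ.^ b * p)                    ≡⟨ blocks (p ℕ.^ b) 0 ⟩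
  p ℕ.^ b * c                                ∎
  where
  open ≡-Reasoning
  p = suc c
  m = p ℕ.^ suc b
  P? = λ k → gcd k m ℕ.≟ 1
  count : (ℕ → ℕ) → ℕ → ℕ
  count f n = length (filter P? (applyUpTo f n))
  count-+ : ∀ f i j → count f (i + j) ≡ count f i + count (λ k → f (i + k)) j
  count-+ f i j = trans (cong (λ ks → length (filter P? ks)) (applyUpTo-+ f i j))
    (trans (cong length (Listₚ.filter-++ P? (applyUpTo f i) _)) (Listₚ.length-++ (filter P? (applyUpTo f i))))
  p∤ : ∀ o {k} → k < c → ¬ p ∣ suc (o * p + k)
  p∤ o {k} k<c p∣ = <⇒∤ (s≤s z≤n) (s≤s k<c) (∣ₚ.∣m+n∣m⇒∣n (subst (p ∣_) (sym (ℕₚ.+-suc (o * p) k)) p∣) (∣ₚ.n∣m*n o))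
  multiple : ∀ o → gcd (suc (o * p + (c + 0))) m ≢ 1
  multiple o gcd≡1 = contradiction
    (∣ₚ.∣1⇒≡1 (subst (p ∣_) gcd≡1 (gcd-greatest (subst (p ∣_) (index o c) (∣ₚ.n∣m*n (suc o))) (∣ₚ.m∣m*n (p ℕ.^ b)))))
    (λ p≡1 → contradiction (subst Prime p≡1 p-prime) λ ())
    where
    index : ∀ o c → suc o * suc c ≡ suc (o * suc c + (c + 0))
    index = ℕ-solve-∀
  block : ∀ o → count (λ k → suc (o * p + k)) p ≡ c
  block o = begin
    count f p                                  ≡⟨ cong (count f) (ℕₚ.+-comm 1 c) ⟩
    count f (c + 1)                            ≡⟨ count-+ f c 1 ⟩
    count f c + count (λ k → f (c + k)) 1      ≡⟨ cong₂ _+_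
      (trans (cong length (Listₚ.filter-all P? (Allₚ.applyUpTo⁺₁ f c (λ k<c → coprime⇒gcd≡1 (∤⇒coprime-^ p-prime (p∤ o k<c) (suc b))))))
             (Listₚ.length-applyUpTo f c))
      (cong length (Listₚ.filter-reject P? {f (c + 0)} {[]} (multiple o))) ⟩
    c + 0                                      ≡⟨ ℕₚ.+-identityʳ c ⟩
    c                                          ∎
    where
    f : ℕ → ℕ
    f k = suc (o * p + k)
  blocks : ∀ j o → count (λ k → suc (o * p + k)) (j * p) ≡ j * c
  blocks zero    o = refl
  blocks (suc j) o = trans (count-+ (λ k → suc (o * p + k)) p (j * p))
    (cong₂ _+_ (block o) (trans (cong (λ ks → length (filter P? ks)) (applyUpTo-cong (j * p) (λ k → cong suc (shift o p k)))) (blocks j (suc o))))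
    where
    shift : ∀ o p k → o * p + (p + k) ≡ p + o * p + k
    shift = ℕ-solve-∀

pos-^ : ∀ m k → + (m ℕ.^ k) ≡ (+ m) ^ k
pos-^ m zero    = refl
pos-^ m (suc k) = trans (ℤₚ.pos-* m (m ℕ.^ k)) (cong (+ m *ℤ_) (pos-^ m k))

divℕ-unique : ∀ d .{{_ : ℕ.NonZero d}} {i} q r → r < d → i ≡ + r +ℤ q *ℤ + d → i divℕ d ≡ q
divℕ-unique (suc d) q r r<d i≡ = proj₂ (divMod-unique d q r r<d i≡)

module Exponents {c : ℕ} (p-prime : Prime (suc c)) (l n : ℕ) (e : ℤ) (ρ : ℕ) (ρ<c : ρ < c)
  (n≡ : + n - 1ℤ - + (l * suc c) ≡ + ρ +ℤ e *ℤ + c) where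
  open PrimePowers p-prime

  private instance
    c≢0 : ℕ.NonZero c
    c≢0 = ℕ.>-nonZero 0<c

  ψexp-1 : ψexp l p 1 n ≡ e
  ψexp-1 = trans (cong₂ _divℕ_ (cong (λ k → + n - 1ℤ - + (l * k)) (ℕₚ.*-identityʳ p)) (trans (totient-^ p-prime 0) (ℕₚ.*-identityˡ c)))
    (divℕ-unique c e ρ ρ<c n≡)

  -- The numerator is p(ρ + ec) + s and the denominator is pc. The remainder pρ + s stays below pc
  -- because ρ ≤ c - 1 and s < p.
  ψexp-2 : ∀ s → s < p → ψexp l p 2 (p * n + s) ≡ e
  ψexp-2 s s<p = trans (cong₂ _divℕ_ refl (trans (totient-^ p-prime 1) (cong (_* c) (ℕₚ.*-identityʳ p))))
    (divℕ-unique (p * c) {{ℕₚ.m*n≢0 p c}} e (p * ρ + s) bound numerator)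
    where
    bound : p * ρ + s < p * c
    bound = ℕₚ.<-≤-trans (ℕₚ.+-monoʳ-< (p * ρ) s<p)
      (subst (_≤ p * c) (trans (ℕₚ.*-suc p ρ) (ℕₚ.+-comm p (p * ρ))) (ℕₚ.*-monoʳ-≤ p ρ<c))
    rearrange : ∀ n s p l → p *ℤ n +ℤ s - p *ℤ 1ℤ - l *ℤ (p *ℤ (p *ℤ 1ℤ)) ≡ p *ℤ (n - 1ℤ - l *ℤ p) +ℤ s
    rearrange = solve-∀
    distribute : ∀ p ρ e c s → p *ℤ (ρ +ℤ e *ℤ c) +ℤ s ≡ p *ℤ ρ +ℤ s +ℤ e *ℤ (p *ℤ c)
    distribute = solve-∀
    open ≡-Reasoning
    numerator : + (p * n + s) - + (p ℕ.^ 1) - + (l * p ℕ.^ 2) ≡ + (p * ρ + s) +ℤ e *ℤ + (p * c)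
    numerator = begin
      + (p * n + s) - + (p ℕ.^ 1) - + (l * p ℕ.^ 2)
        ≡⟨ cong₂ (λ u v → u - v - + (l * p ℕ.^ 2)) (cong (_+ℤ + s) (ℤₚ.pos-* p n)) (pos-^ p 1) ⟩
      + p *ℤ + n +ℤ + s - + p *ℤ 1ℤ - + (l * p ℕ.^ 2)
        ≡⟨ cong (λ u → + p *ℤ + n +ℤ + s - + p *ℤ 1ℤ - u) (trans (ℤₚ.pos-* l (p ℕ.^ 2)) (cong (+ l *ℤ_) (pos-^ p 2))) ⟩
      + p *ℤ + n +ℤ + s - + p *ℤ 1ℤ - + l *ℤ (+ p *ℤ (+ p *ℤ 1ℤ))
        ≡⟨ rearrange (+ n) (+ s) (+ p) (+ l) ⟩
      + p *ℤ (+ n - 1ℤ - + l *ℤ + p) +ℤ + s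
        ≡⟨ cong (λ u → + p *ℤ u +ℤ + s) (trans (cong (λ u → + n - 1ℤ - u) (sym (ℤₚ.pos-* l p))) n≡) ⟩
      + p *ℤ (+ ρ +ℤ e *ℤ + c) +ℤ + s
        ≡⟨ distribute (+ p) (+ ρ) e (+ c) (+ s) ⟩
      + p *ℤ + ρ +ℤ + s +ℤ e *ℤ (+ p *ℤ + c)
        ≡⟨ cong₂ (λ u v → u +ℤ + s +ℤ e *ℤ v) (ℤₚ.pos-* p ρ) (ℤₚ.pos-* p c) ⟨
      + (p * ρ + s) +ℤ e *ℤ + (p * c) ∎

scaleByNegPow-exact : ∀ p .{{_ : ℕ.NonZero p}} e {x} → (+ p) ^ e ∣ˢ x → scaleByNegPow p (+ e) x *ℤ (+ p) ^ e ≡ x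
scaleByNegPow-exact p e {x} d = trans (cong (x divℕ (p ℕ.^ e) *ℤ_) (sym (pos-^ p e)))
  (exact-divℕ {{ℕₚ.m^n≢0 p e}} (subst (_∣ˢ x) (sym (pos-^ p e)) d))

^-cancel-∣ : ∀ p .{{_ : ℕ.NonZero p}} e {x} → (+ p) ^ suc e ∣ˢ x *ℤ (+ p) ^ e → + p ∣ˢ x
^-cancel-∣ p e = S.*-cancelʳ-∣ ((+ p) ^ e) {{subst ℤ.NonZero (pos-^ p e) (ℕₚ.m^n≢0 p e)}}

-- Congruences for a non-negative normalising exponent

module NonNegativeExponent {c : ℕ} (p-prime : Prime (suc c)) (l e ρ : ℕ) (r : ℤ) (s t : ℕ) (s<p : s < suc c) (t<p : t < suc c) where
  open PrimePowers p-prime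
  open Expansion p-prime l
  open ResidueSums p-prime

  -- The equation n - 1 - lp = ρ + ec solved for n, which makes n a successor, as the first-order
  -- expansion requires.
  n′ n : ℕ
  n′ = l * p + ρ + e * c
  n  = suc n′

  a κ X V Z : ℤ
  a = (- r) *ℤ + p - + t
  κ = (-1ℤ ^ t) *ℤ + (s C t)
  X = rawψ l p 2 (p * n + s) (+ p *ℤ r +ℤ + t)
  V = rawψ l p 1 n r
  Z = correction s n′ a

  X≡ : X ≡ ⟦ δ ^ᵒ (p * n + s) ⟧ Φ a
  X≡ = trans (rawψ-δ l p 2 (p * n + s) (+ p *ℤ r +ℤ + t))
    (trans (⟦⟧-cong (δ ^ᵒ (p * n + s)) Φ≡ _) (cong (⟦ δ ^ᵒ (p * n + s) ⟧ Φ) (negate (+ p) r (+ t))))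
    where
    negate : ∀ p r t → - (p *ℤ r +ℤ t) ≡ (- r) *ℤ p - t
    negate = solve-∀
    Φ≡ : ∀ k → spread (p ℕ.^ 2) (binom l) k ≡ Φ k
    Φ≡ k = trans (cong (λ q → spread (p * q) (binom l) k) (ℕₚ.*-identityʳ p)) (spread-* p p (binom l) k)

  V≡ : V ≡ T l n (- r)
  V≡ = trans (rawψ-δ l p 1 n r) (cong (λ q → ⟦ δ ^ᵒ n ⟧ (spread q (binom l)) (- r)) (ℕₚ.*-identityʳ p))

  lower-bound : e * c + suc (l * p) ≤ n
  lower-bound = subst (_≤ n) (trans (cong suc (ℕₚ.+-comm (l * p) (e * c))) (sym (ℕₚ.+-suc (e * c) (l * p))))
    (s≤s (ℕₚ.+-monoˡ-≤ (e * c) (ℕₚ.m≤m+n (l * p) ρ)))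

  X-expansion : (+ p) ^ suc e ∣ˢ X - (κ *ℤ V +ℤ + n *ℤ Z)
  X-expansion = ∣-resp (cong₂ (λ x v → x - (v +ℤ + n *ℤ Z)) (sym X≡) main-term) (main-expansion e n′ lower-bound s a)
    where
    main-term : ⟦ δ ^ᵒ s ⟧ (spread p (T l n)) a ≡ κ *ℤ V
    main-term = trans (δ^-spread p s t (T l n) (- r) (ℕₚ.<⇒≤ s<p) t<p (inj₂ s<p)) (cong (κ *ℤ_) (sym V≡))

  V-∣ : (+ p) ^ e ∣ˢ V
  V-∣ = ∣-resp (sym V≡) (T-∣ l e n lower-bound (- r))

  Z-∣ : (+ p) ^ e ∣ˢ Z
  Z-∣ = correction-∣′ e s n′ lower-bound a

  X-∣ : (+ p) ^ e ∣ˢ X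
  X-∣ = ∣-resp (cancel X (κ *ℤ V +ℤ + n *ℤ Z)) (S.∣m∣n⇒∣m+n (S.∣-trans (S.∣n⇒∣m*n (+ p) S.∣-refl) X-expansion)
    (S.∣m∣n⇒∣m+n (S.∣n⇒∣m*n κ V-∣) (S.∣n⇒∣m*n (+ n) Z-∣)))
    where
    cancel : ∀ x y → x - y +ℤ y ≡ x
    cancel = solve-∀

  A B : ℤ
  A = scaleByNegPow p (+ e) X
  B = scaleByNegPow p (+ e) V

  A≡ : A *ℤ (+ p) ^ e ≡ X
  A≡ = scaleByNegPow-exact p e X-∣

  B≡ : B *ℤ (+ p) ^ e ≡ V
  B≡ = scaleByNegPow-exact p e V-∣

  congruent : (+ p) ^ suc e ∣ˢ + n *ℤ Z → + p ∣ˢ A - κ *ℤ B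
  congruent nZ = ^-cancel-∣ p e (∣-resp eq (S.∣m∣n⇒∣m+n X-expansion nZ))
    where
    cancel : ∀ x v z → x - (v +ℤ z) +ℤ z ≡ x - v
    cancel = solve-∀
    factor : ∀ a k b q → a *ℤ q - k *ℤ (b *ℤ q) ≡ (a - k *ℤ b) *ℤ q
    factor = solve-∀
    eq : X - (κ *ℤ V +ℤ + n *ℤ Z) +ℤ + n *ℤ Z ≡ (A - κ *ℤ B) *ℤ (+ p) ^ e
    eq = trans (cancel X (κ *ℤ V) (+ n *ℤ Z))
      (trans (cong₂ (λ x v → x - κ *ℤ v) (sym A≡) (sym B≡)) (factor A κ B ((+ p) ^ e)))

  nZ-∣-if-p∣n : p ∣ n → (+ p) ^ suc e ∣ˢ + n *ℤ Z
  nZ-∣-if-p∣n p∣n = product (S.∣ᵤ⇒∣ {+ p} {+ n} p∣n) Z-∣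
    where
    regroup : ∀ q p z P → q *ℤ z *ℤ (p *ℤ P) ≡ q *ℤ p *ℤ (z *ℤ P)
    regroup = solve-∀
    product : ∀ {x y} → + p ∣ˢ x → (+ p) ^ e ∣ˢ y → (+ p) ^ suc e ∣ˢ x *ℤ y
    product (divides q refl) (divides z refl) = divides (q *ℤ z) (sym (regroup q (+ p) z ((+ p) ^ e)))

  -- If ρ ≥ 1, then n - 1 still lies above the threshold for p^e, and the factor p of the correction
  -- adds one more power.
  Z-∣-if-ρ≢0 : ρ ≢ 0 → (+ p) ^ suc e ∣ˢ Z
  Z-∣-if-ρ≢0 ρ≢0 = correction-∣ e s n′ (subst (_≤ n′) (rotate (l * p) (e * c)) (ℕₚ.+-monoˡ-≤ (e * c) (ℕₚ.+-monoʳ-≤ (l * p) (ℕₚ.n≢0⇒n>0 ρ≢0)))) a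
    where
    rotate : ∀ x y → x + 1 + y ≡ y + suc x
    rotate = ℕ-solve-∀

  n′≡ : ∀ e′ → ρ ≡ 0 → e ≡ suc e′ → n′ ≡ l * p + suc e′ * c
  n′≡ e′ refl refl = cong (_+ suc e′ * c) (ℕₚ.+-identityʳ (l * p))

  -- For ρ = 0 and e > 0 the leading coefficient supplies p^(e-1) and the sum of length s + p
  -- supplies p². For e = 0 the explicit factor p is enough.
  Z-∣-if-T₀ : (∀ u → (+ p) ^ 2 ∣ˢ T 0 (s + p) (u *ℤ + p - + t)) → (+ p) ^ suc e ∣ˢ Z
  Z-∣-if-T₀ T₀ with ρ ℕ.≟ 0
  ... | no ρ≢0  = Z-∣-if-ρ≢0 ρ≢0
  ... | yes ρ≡0 = by-exponent e refl
    where
    cancel : ∀ x y → x - y +ℤ y ≡ x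
    cancel = solve-∀
    by-exponent : ∀ k → e ≡ k → (+ p) ^ suc e ∣ˢ Z
    by-exponent zero     refl = correction-p∣ s n′ a
    by-exponent (suc e′) refl = ∣-resp (cancel Z (lead l e′ *ℤ T 0 (s + p) a))
      (S.∣m∣n⇒∣m+n (correction-lead e′ s n′ (n′≡ e′ ρ≡0 refl) a) (lead-* l e′ (T₀ (- r))))

  module _ (s<t : s < t) where

    κ≡0 : κ ≡ 0ℤ
    κ≡0 = trans (cong (λ b → (-1ℤ ^ t) *ℤ + b) (k>n⇒nCk≡0 s<t)) (ℤₚ.*-zeroʳ (-1ℤ ^ t))

    vanishes : e ≡ 0 → + p ∣ˢ A
    vanishes refl = ∣-resp (trans (cong (λ k → A - k *ℤ B) κ≡0) (ℤₚ.+-identityʳ A))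
      (congruent (S.∣n⇒∣m*n (+ n) (correction-p∣ s n′ a)))

    nonvanishing : ∀ e′ → ρ ≡ 0 → e ≡ suc e′ → ∀ m → m ≡ e + l →
      + p ∣ˢ + t *ℤ + ((t ∸ 1) C s) *ℤ A - (-1ℤ ^ (s + m)) *ℤ + n *ℤ + ((m ∸ 1) C l)
    nonvanishing e′ ρ≡0 refl m refl = ^-cancel-∣ p e (∣-resp eq
      -- Three congruences modulo p^(e+1), weighted so that the correction and then the sum of
      -- length s + p cancel. The main term is absent because C(s, t) = 0.
      (S.∣m∣n⇒∣m+n (S.∣m∣n⇒∣m+n (S.∣n⇒∣m*n τ X-expansion)
                                (S.∣n⇒∣m*n (τ *ℤ + n) (correction-lead e′ s n′ (n′≡ e′ ρ≡0 refl) a)))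
                   (S.∣n⇒∣m*n (+ n) (lead-* l e′ (T₀-below s t s<t t<p (- r))))))
      where
      τ = + t *ℤ + ((t ∸ 1) C s)
      b = (e′ + l) C l
      σ = -1ℤ ^ suc s
      L = lead l e′
      T₀ = T 0 (s + p) a
      telescope : ∀ τ x v n z L T σ p →
        τ *ℤ (x - (0ℤ *ℤ v +ℤ n *ℤ z)) +ℤ τ *ℤ n *ℤ (z - L *ℤ T) +ℤ n *ℤ (L *ℤ (τ *ℤ T - σ *ℤ p))
          ≡ τ *ℤ x - n *ℤ (L *ℤ (σ *ℤ p))
      telescope = solve-∀
      collect : ∀ τ A p P n σ′ s b → τ *ℤ (A *ℤ (p *ℤ P)) - n *ℤ (σ′ *ℤ b *ℤ P *ℤ (-1ℤ *ℤ s *ℤ p)) ≡ (τ *ℤ A - (s *ℤ (-1ℤ *ℤ σ′)) *ℤ n *ℤ b) *ℤ (p *ℤ P)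
      collect = solve-∀
      eq : τ *ℤ (X - (κ *ℤ V +ℤ + n *ℤ Z)) +ℤ τ *ℤ + n *ℤ (Z - L *ℤ T₀) +ℤ + n *ℤ (L *ℤ (τ *ℤ T₀ - σ *ℤ + p))
         ≡ (τ *ℤ A - (-1ℤ ^ (s + suc (e′ + l))) *ℤ + n *ℤ + b) *ℤ (+ p) ^ e
      eq = trans (cong (λ k → τ *ℤ (X - (k *ℤ V +ℤ + n *ℤ Z)) +ℤ τ *ℤ + n *ℤ (Z - L *ℤ T₀) +ℤ + n *ℤ (L *ℤ (τ *ℤ T₀ - σ *ℤ + p))) κ≡0)
        (trans (telescope τ X V (+ n) Z L T₀ σ (+ p))
          (trans (cong (λ x → τ *ℤ x - + n *ℤ (L *ℤ (σ *ℤ + p))) (sym A≡))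
            (trans (collect τ A (+ p) ((+ p) ^ e′) (+ n) (-1ℤ ^ (e′ + l)) (-1ℤ ^ s) (+ b))
              (cong (λ σ → (τ *ℤ A - σ *ℤ + n *ℤ + b) *ℤ (+ p) ^ e) (sym (ℤₚ.^-distribˡ-+-* -1ℤ s (suc (e′ + l))))))))

-- Case distinction on the exponent and the final congruences

Condition : (p l n s t : ℕ) → Set
Condition p l n s t = p ∣ n ⊎ ¬ ((+ (p ∸ 1)) ∣ℤ (+ n - + l - + 1)) ⊎ s ≡ p ∸ 1 ⊎ (s ≡ 2 * t × p ≢ 2)

module Cases {c : ℕ} (p-prime : Prime (suc c)) (l : ℕ) (r : ℤ) (s t : ℕ) (s<p : s < suc c) (t<p : t < suc c) where
  open PrimePowers p-prime
  open ResidueSums p-prime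

  κ τ : ℤ
  κ = (-1ℤ ^ t) *ℤ + (s C t)
  τ = + t *ℤ + ((t ∸ 1) C s)

  X V : ℕ → ℤ
  X n = rawψ l p 2 (p * n + s) (+ p *ℤ r +ℤ + t)
  V n = rawψ l p 1 n r

  p∣scaled : ∀ k x → + p ∣ˢ scaleByNegPow p -[1+ k ] x
  p∣scaled k x = S.∣n⇒∣m*n x (subst (+ p ∣ˢ_) (sym (ℤₚ.pos-* p (p ℕ.^ k))) (S.∣m⇒∣m*n (+ (p ℕ.^ k)) S.∣-refl))

  n≡-nonNeg : ∀ n ρ e → + n - 1ℤ - + (l * p) ≡ + ρ +ℤ + e *ℤ + c → n ≡ suc (l * p + ρ + e * c)
  n≡-nonNeg n ρ e eq = ℤₚ.+-injective (begin
    + n                                            ≡⟨ restore (+ n) (+ (l * p)) ⟨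
    + n - 1ℤ - + (l * p) +ℤ + (l * p) +ℤ 1ℤ        ≡⟨ cong (λ x → x +ℤ + (l * p) +ℤ 1ℤ) eq ⟩
    + ρ +ℤ + e *ℤ + c +ℤ + (l * p) +ℤ 1ℤ           ≡⟨ cong (λ x → + ρ +ℤ x +ℤ + (l * p) +ℤ 1ℤ) (ℤₚ.pos-* e c) ⟨
    + ρ +ℤ + (e * c) +ℤ + (l * p) +ℤ 1ℤ            ≡⟨ reorder (+ ρ) (+ (e * c)) (+ (l * p)) ⟩
    + suc (l * p + ρ + e * c)                      ∎)
    where
    open ≡-Reasoning
    restore : ∀ n x → n - 1ℤ - x +ℤ x +ℤ 1ℤ ≡ n
    restore = solve-∀
    reorder : ∀ ρ y x → ρ +ℤ y +ℤ x +ℤ 1ℤ ≡ 1ℤ +ℤ (x +ℤ ρ +ℤ y)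
    reorder = solve-∀

  -- Since p = c + 1, the term lp contributes l + lc. So ρ is also the remainder of n - l - 1 modulo
  -- c, and for ρ = 0 the quotient (n - l - 1)/(p - 1) is l + e.
  n-l-1≡ : ∀ ρ e → + suc (l * p + ρ + e * c) - + l - 1ℤ ≡ + ρ +ℤ + (l + e) *ℤ + c
  n-l-1≡ ρ e = trans (cong₂ (λ x y → 1ℤ +ℤ (x +ℤ + ρ +ℤ y) - + l - 1ℤ) (ℤₚ.pos-* l p) (ℤₚ.pos-* e c)) (simplify (+ l) (+ ρ) (+ e) (+ c))
    where
    simplify : ∀ l ρ e c → 1ℤ +ℤ (l *ℤ (1ℤ +ℤ c) +ℤ ρ +ℤ e *ℤ c) - l - 1ℤ ≡ ρ +ℤ (l +ℤ e) *ℤ c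
    simplify = solve-∀

  ρ≡0⇒c∣ : ∀ ρ e → ρ ≡ 0 → + c ∣ℤ (+ suc (l * p + ρ + e * c) - + l - 1ℤ)
  ρ≡0⇒c∣ ρ e refl = S.∣⇒∣ᵤ {+ c} (divides (+ (l + e)) (trans (n-l-1≡ 0 e) (ℤₚ.+-identityˡ (+ (l + e) *ℤ + c))))

  c∣⇒ρ≡0 : ∀ ρ e → ρ < c → + c ∣ℤ (+ suc (l * p + ρ + e * c) - + l - 1ℤ) → ρ ≡ 0
  c∣⇒ρ≡0 zero    e ρ<c _   = refl
  c∣⇒ρ≡0 (suc ρ) e ρ<c c∣n = contradiction
    (S.∣⇒∣ᵤ {+ c} {+ suc ρ} (S.∣m+n∣n⇒∣m (∣-resp (n-l-1≡ (suc ρ) e) (S.∣ᵤ⇒∣ {+ c} c∣n)) (S.∣n⇒∣m*n (+ (l + e)) S.∣-refl)))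
    (<⇒∤ (s≤s z≤n) ρ<c)

  c≢0 : ℕ.NonZero c
  c≢0 = ℕ.>-nonZero 0<c

  ψ-congruence : ∀ n e ρ → ρ < c → + n - 1ℤ - + (l * p) ≡ + ρ +ℤ e *ℤ + c → Condition p l n s t →
    + p ∣ˢ scaleByNegPow p e (X n) - κ *ℤ scaleByNegPow p e (V n)
  ψ-congruence n -[1+ k ] ρ ρ<c n≡ _ = S.∣m∣n⇒∣m-n (p∣scaled k (X n)) (S.∣n⇒∣m*n κ (p∣scaled k (V n)))
  ψ-congruence n (+ e) ρ ρ<c n≡ condition with n≡-nonNeg n ρ e n≡
  ... | refl = congruent (by-condition condition)
    where
    open NonNegativeExponent p-prime l e ρ r s t s<p t<p using (Z; congruent; nZ-∣-if-p∣n; Z-∣-if-ρ≢0; Z-∣-if-T₀)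
    by-condition : Condition p l n s t → (+ p) ^ suc e ∣ˢ + n *ℤ Z
    by-condition (inj₁ p∣n)                             = nZ-∣-if-p∣n p∣n
    by-condition (inj₂ (inj₁ c∤))                       = S.∣n⇒∣m*n (+ n) (Z-∣-if-ρ≢0 (λ ρ≡0 → c∤ (ρ≡0⇒c∣ ρ e ρ≡0)))
    -- For s = p - 1 the length s + p = 2(p - 1) + 1 is exactly the threshold for p² when l = 0.
    by-condition (inj₂ (inj₂ (inj₁ refl)))              = S.∣n⇒∣m*n (+ n) (Z-∣-if-T₀ (λ u → T-∣ 0 2 (s + p) (ℕₚ.≤-reflexive (double c)) (u *ℤ + p - + t)))
      where
      double : ∀ c → 2 * c + 1 ≡ c + suc c
      double = ℕ-solve-∀
    by-condition (inj₂ (inj₂ (inj₂ (refl , p≢2))))      = S.∣n⇒∣m*n (+ n) (Z-∣-if-T₀ (λ u → ∣-resp (sym (T₀-symmetric p≢2 t u)) (divides 0ℤ refl)))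

  -- The value m = 0 must be excluded: truncated subtraction would give C(0, l), which is 1 for l =
  -- 0.
  C-vanishes : ∀ m → m ≤ l → m ≢ 0 → (m ∸ 1) C l ≡ 0
  C-vanishes zero    _   m≢0 = contradiction refl m≢0
  C-vanishes (suc m) m<l _   = k>n⇒nCk≡0 m<l

  p∣-without-C : ∀ y n′ {x} m → m ≤ l → m ≢ 0 → + p ∣ˢ x → + p ∣ˢ τ *ℤ x - y *ℤ n′ *ℤ + ((m ∸ 1) C l)
  p∣-without-C y n′ {x} m m≤l m≢0 p∣x rewrite C-vanishes m m≤l m≢0 =
    ∣-resp (sym (trans (cong (λ z → τ *ℤ x - z) (ℤₚ.*-zeroʳ (y *ℤ n′))) (ℤₚ.+-identityʳ (τ *ℤ x)))) (S.∣n⇒∣m*n τ p∣x)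

  ψ-value : s < t → ∀ n e ρ → ρ < c → + n - 1ℤ - + (l * p) ≡ + ρ +ℤ e *ℤ + c → + c ∣ℤ (+ n - + l - + 1) →
    ∀ m → m ≢ 0 → n ≡ l + 1 + m * c →
    + p ∣ˢ τ *ℤ scaleByNegPow p e (X n) - (-1ℤ ^ (s + m)) *ℤ + n *ℤ + ((m ∸ 1) C l)
  -- A negative exponent makes the left side divisible by p and forces m ≤ l, so the binomial
  -- coefficient on the right vanishes too.
  ψ-value s<t n -[1+ k ] ρ ρ<c n≡ _ m m≢0 n≡m = p∣-without-C (-1ℤ ^ (s + m)) (+ n) m m≤l m≢0 (p∣scaled k (X n))
    where
    balanceℤ : + (m * c) +ℤ + (suc k * c) ≡ + ρ +ℤ + (l * c)
    balanceℤ = begin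
      + (m * c) +ℤ + (suc k * c)
        ≡⟨ cong₂ _+ℤ_ (ℤₚ.pos-* m c) (ℤₚ.pos-* (suc k) c) ⟩
      + m *ℤ + c +ℤ + suc k *ℤ + c
        ≡⟨ rewrite-lhs (+ m) (+ c) (+ suc k) (+ l) ⟩
      (+ l +ℤ 1ℤ +ℤ + m *ℤ + c - 1ℤ - + l *ℤ (1ℤ +ℤ + c)) +ℤ + suc k *ℤ + c +ℤ + l *ℤ + c
        ≡⟨ cong (λ x → x +ℤ + suc k *ℤ + c +ℤ + l *ℤ + c) n≡′ ⟩
      + ρ +ℤ - (+ suc k) *ℤ + c +ℤ + suc k *ℤ + c +ℤ + l *ℤ + c
        ≡⟨ rewrite-rhs (+ ρ) (+ suc k) (+ c) (+ l) ⟩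
      + ρ +ℤ + l *ℤ + c
        ≡⟨ cong (+ ρ +ℤ_) (ℤₚ.pos-* l c) ⟨
      + ρ +ℤ + (l * c) ∎
      where
      open ≡-Reasoning
      rewrite-lhs : ∀ m c k l → m *ℤ c +ℤ k *ℤ c ≡ (l +ℤ 1ℤ +ℤ m *ℤ c - 1ℤ - l *ℤ (1ℤ +ℤ c)) +ℤ k *ℤ c +ℤ l *ℤ c
      rewrite-lhs = solve-∀
      rewrite-rhs : ∀ ρ k c l → ρ +ℤ - k *ℤ c +ℤ k *ℤ c +ℤ l *ℤ c ≡ ρ +ℤ l *ℤ c
      rewrite-rhs = solve-∀
      n≡′ : + l +ℤ 1ℤ +ℤ + m *ℤ + c - 1ℤ - + l *ℤ (1ℤ +ℤ + c) ≡ + ρ +ℤ - (+ suc k) *ℤ + c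
      n≡′ = trans (cong₂ (λ x y → + l +ℤ 1ℤ +ℤ x - 1ℤ - y) (sym (ℤₚ.pos-* m c)) (sym (ℤₚ.pos-* l p)))
        (trans (cong (λ n → + n - 1ℤ - + (l * p)) (sym n≡m)) n≡)
    balance : m * c + suc k * c ≡ ρ + l * c
    balance = ℤₚ.+-injective balanceℤ
    m≤l : m ≤ l
    m≤l = ℕₚ.≤-pred (ℕₚ.*-cancelʳ-< c m (suc l) (ℕₚ.≤-<-trans (ℕₚ.m≤m+n (m * c) (suc k * c))
      (subst (_< suc l * c) (sym balance) (ℕₚ.+-monoˡ-< (l * c) ρ<c))))
  ψ-value s<t n (+ e) ρ ρ<c n≡ c∣ m m≢0 n≡m with n≡-nonNeg n ρ e n≡
  ... | refl = by-exponent e refl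
    where
    open NonNegativeExponent p-prime l e ρ r s t s<p t<p using (vanishes; nonvanishing)
    ρ≡0 : ρ ≡ 0
    ρ≡0 = c∣⇒ρ≡0 ρ e ρ<c c∣
    m≡e+l : m ≡ e + l
    m≡e+l = sym (ℕₚ.*-cancelʳ-≡ (e + l) m c {{c≢0}} (ℕₚ.+-cancelˡ-≡ (l + 1) _ _
      (trans (regroup l c e) (trans (cong (λ ρ → suc (l * p + ρ + e * c)) (sym ρ≡0)) n≡m))))
      where
      regroup : ∀ l c e → l + 1 + (e + l) * c ≡ suc (l * suc c + 0 + e * c)
      regroup = ℕ-solve-∀
    by-exponent : ∀ k → e ≡ k → + p ∣ˢ τ *ℤ scaleByNegPow p (+ e) (X n) - (-1ℤ ^ (s + m)) *ℤ + n *ℤ + ((m ∸ 1) C l)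
    -- Here m = l, so C(m - 1, l) = 0 agrees with the vanishing of the left side.
    by-exponent zero     e≡0 = p∣-without-C (-1ℤ ^ (s + m)) (+ n) m (ℕₚ.≤-reflexive (trans m≡e+l (cong (_+ l) e≡0))) m≢0 (vanishes s<t e≡0)
    by-exponent (suc e′) e≡  = nonvanishing s<t e′ ρ≡0 e≡ m m≡e+l

  ψ-vanishing : s < t → ∀ n e ρ → ρ < c → + n - 1ℤ - + (l * p) ≡ + ρ +ℤ e *ℤ + c → n ≤ l + 1 →
    + p ∣ˢ scaleByNegPow p e (X n)
  ψ-vanishing s<t n -[1+ k ] ρ ρ<c n≡ _ = p∣scaled k (X n)
  ψ-vanishing s<t n (+ e) ρ ρ<c n≡ n≤l+1 with n≡-nonNeg n ρ e n≡
  -- From l + e ≤ lp + ρ + ec = n - 1 ≤ l it follows that e = 0.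
  ... | refl = vanishes s<t (ℕₚ.n≤0⇒n≡0 (ℕₚ.+-cancelˡ-≤ l _ _ (ℕₚ.≤-trans l+e≤ (subst (l * p + ρ + e * c ≤_) (sym (ℕₚ.+-identityʳ l)) (ℕₚ.≤-pred (subst (n ≤_) (ℕₚ.+-comm l 1) n≤l+1))))))
    where
    open NonNegativeExponent p-prime l e ρ r s t s<p t<p using (vanishes)
    l+e≤ : l + e ≤ l * p + ρ + e * c
    l+e≤ = ℕₚ.+-mono-≤ (ℕₚ.≤-trans (ℕₚ.m≤m*n l p) (ℕₚ.m≤m+n (l * p) ρ)) (ℕₚ.m≤m*n e c {{c≢0}})

theorem1p2 : (p : ℕ) → Prime p → (l n : ℕ) → (r : ℤ) → (s t : ℕ) → s < p → t < p →
    ((p ∣ n ⊎ ¬ ((+ (p ∸ 1)) ∣ℤ (+ n - + l - + 1)) ⊎ s ≡ p ∸ 1 ⊎ (s ≡ 2 * t × p ≢ 2)) →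
    ψcoeff l p 2 (p * n + s) (+ p *ℤ r +ℤ + t)
    ≡ (-1ℤ ^ t) *ℤ + (s C t) *ℤ ψcoeff l p 1 n r [mod p ])
    × ((¬ (p ∣ n) → (+ (p ∸ 1)) ∣ℤ (+ n - + l - + 1) → s < t →
    ((n > l + 1 → (m : ℕ) → n ≡ l + 1 + m * (p ∸ 1) →
    (+ t *ℤ + ((t ∸ 1) C s)) *ℤ ψcoeff l p 2 (p * n + s) (+ p *ℤ r +ℤ + t)
    ≡ (-1ℤ ^ (s + m)) *ℤ + n *ℤ + ((m ∸ 1) C l) [mod p ])
    × (n ≤ l + 1 → ψcoeff l p 2 (p * n + s) (+ p *ℤ r +ℤ + t) ≡ 0ℤ [mod p ]))))
theorem1p2 zero () l n r s t s<p t<p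
theorem1p2 p@(suc c) p-prime l n r s t s<p t<p
  -- This single Euclidean division yields the common exponent e of both normalisations and the
  -- remainder ρ that decides the cases.
  with residue-of c {{Cases.c≢0 p-prime l r s t s<p t<p}} (+ n - 1ℤ - + (l * p))
... | residue e ρ ρ<c n≡ =
  (λ condition → S.∣⇒∣ᵤ {+ p} (subst₂ (λ e₂ e₁ → + p ∣ˢ scaleByNegPow p e₂ (X n) - κ *ℤ scaleByNegPow p e₁ (V n))
                                (sym e₂≡) (sym ψexp-1) (ψ-congruence n e ρ ρ<c n≡ condition))) ,
  λ p∤n c∣ s<t →
    (λ n>l+1 m n≡m → S.∣⇒∣ᵤ {+ p} (subst (λ e → + p ∣ˢ τ *ℤ scaleByNegPow p e (X n) - (-1ℤ ^ (s + m)) *ℤ + n *ℤ + ((m ∸ 1) C l))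
       (sym e₂≡) (ψ-value s<t n e ρ ρ<c n≡ c∣ m (m≢0 n>l+1 n≡m) n≡m))) ,
    λ n≤l+1 → S.∣⇒∣ᵤ {+ p} (∣-resp (sym (ℤₚ.+-identityʳ _)) (subst (λ e → + p ∣ˢ scaleByNegPow p e (X n))
       (sym e₂≡) (ψ-vanishing s<t n e ρ ρ<c n≡ n≤l+1)))
  where
  open Cases p-prime l r s t s<p t<p
  open Exponents p-prime l n e ρ ρ<c n≡
  e₂≡ = ψexp-2 s s<p
  m≢0 : n > l + 1 → ∀ {m} → n ≡ l + 1 + m * c → m ≢ 0
  m≢0 n>l+1 n≡m refl = contradiction (trans n≡m (ℕₚ.+-identityʳ (l + 1))) (ℕₚ.>⇒≢ n>l+1)
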